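{- Let $G_{14}$ be the graph with the $14$ vertices $\{a,b,c,d\}\cup\{u_0,u_1,u_2,u_3,u_4\}\cup\{v_0,v_1,v_2,v_3,v_4\}$ (all distinct) and the following $16$ edges: the square edges $ab, bc, cd, da$; the pentagon edges $u_0u_1, u_1u_2, u_2u_3, u_3u_4, u_4u_0$; the pentagon edges $v_0v_1, v_1v_2, v_2v_3, v_3v_4, v_4v_0$; and the two bridges $au_0$ and $bv_0$. Then the line graph $L(G_{14})$ has inertia $\mathrm{In}(L(G_{14})) = (9,0,7)$. Hence $s(L(G_{14})) = 2$, and the assertion "for every connected graph $G$, $n^{+}(L(G)) \le n^{ - }(L(G)) + 1$" is false.
   Context: All graphs are finite and simple. For a graph $H$ with adjacency matrix $A(H)$, $n^{+}(H)$, $n^{0}(H)$, $n^{ - }(H)$ denote the numbers of positive, zero and negative eigenvalues of $A(H)$, counted with multiplicity; the inertia is $\mathrm{In}(H) = (n^{+}(H), n^{0}(H), n^{ - }(H))$ and the signature is $s(H) = n^{+}(H) - n^{ - }(H)$. The line graph $L(G)$ has the edges of $G$ as vertices, two being adjacent when they are distinct and share an endpoint. -}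

module Defs where

open import Algebra.Bundles.Raw using (RawRing)
import Algebra.Definitions.RawSemiring as RawSemiringOps
open import Data.Bool.Base using (if_then_else_)
open import Data.Fin using (#_)
open import Data.Fin.Base as Fin using (Fin; toℕ; punchIn; _↑ˡ_; _↑ʳ_)
import Data.Fin.Properties as Fin
open import Data.Integer.Base using (ℤ; _⊖_)
open import Data.List.Base using (List; []; _∷_; length; lookup; allFin; filter; cartesianProduct)
import Data.List.Membership.DecPropositional as DecMembership
open import Data.Nat.Base as ℕ using (ℕ; suc)
import Data.Nat.Properties as ℕ
open import Data.Product.Base using (_×_; _,_; ∃-syntax; proj₁; proj₂)
open import Data.Product.Properties using () renaming (≡-dec to ×-≡-dec)
open import Data.Rational.Base as ℚ using (ℚ; 0ℚ; 1ℚ; ½; ∣_∣; 1/_)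
import Data.Rational.Properties as ℚ
open import Data.Rational.Solver using (module +-*-Solver)
open import Data.Sum.Base using (_⊎_; inj₁; inj₂; swap)
open import Data.Vec.Base using (Vec; []; _∷_) renaming (lookup to lookupᵛ)
open import Function.Base using (_∘_)
open import Level using (0ℓ)
open import Relation.Binary.Core using (Rel)
open import Relation.Binary.Construct.Closure.ReflexiveTransitive using (Star)
open import Relation.Binary.Definitions using (Decidable; Irreflexive; Symmetric)
open import Relation.Binary.PropositionalEquality
  using (_≡_; _≢_; refl; sym; trans; cong; subst)
open import Relation.Nullary.Decidable
  using (does; ¬?; _×-dec_; _⊎-dec_; toWitness)

-- Real numbers are Cauchy sequences of rationals; _≈_, not _≡_, is
-- equality of reals.

Cauchy : (ℕ → ℚ) → Set
Cauchy f = ∀ ε → 0ℚ ℚ.< ε →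
  ∃[ N ] (∀ {m n} → N ℕ.≤ m → N ℕ.≤ n → ∣ f m ℚ.- f n ∣ ℚ.≤ ε)

record ℝ : Set where
  constructor mkℝ
  field
    seq    : ℕ → ℚ
    cauchy : Cauchy seq

open ℝ public

infix 4 _≈_ _<_

_≈_ : Rel ℝ 0ℓ
x ≈ y = ∀ ε → 0ℚ ℚ.< ε →
  ∃[ N ] (∀ {n} → N ℕ.≤ n → ∣ seq x n ℚ.- seq y n ∣ ℚ.≤ ε)

_<_ : Rel ℝ 0ℓ
x < y = ∃[ ε ] (0ℚ ℚ.< ε ×
  ∃[ N ] (∀ {n} → N ℕ.≤ n → seq x n ℚ.+ ε ℚ.≤ seq y n))

private
  half-pos : ∀ {ε} → 0ℚ ℚ.< ε → 0ℚ ℚ.< ½ ℚ.* ε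
  half-pos {ε} 0<ε = subst (ℚ._< ½ ℚ.* ε) (ℚ.*-zeroʳ ½) (ℚ.*-monoʳ-<-pos ½ 0<ε)

  half+half : ∀ ε → ½ ℚ.* ε ℚ.+ ½ ℚ.* ε ≡ ε
  half+half ε = trans (sym (ℚ.*-distribʳ-+ ε ½ ½)) (ℚ.*-identityˡ ε)

  const-cauchy : ∀ q → Cauchy (λ _ → q)
  const-cauchy q ε 0<ε = 0 , λ _ _ →
    subst (λ r → ∣ r ∣ ℚ.≤ ε) (sym (ℚ.+-inverseʳ q)) (ℚ.<⇒≤ 0<ε)

  +-cauchy : ∀ {f g} → Cauchy f → Cauchy g → Cauchy (λ n → f n ℚ.+ g n)
  +-cauchy {f} {g} cf cg ε 0<ε
    with cf (½ ℚ.* ε) (half-pos 0<ε) | cg (½ ℚ.* ε) (half-pos 0<ε)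
  ... | M , hf | N , hg = M ℕ.⊔ N , λ {m} {n} ≤m ≤n → begin
    ∣ (f m ℚ.+ g m) ℚ.- (f n ℚ.+ g n) ∣
      ≡⟨ cong ∣_∣ (rearrange (f m) (g m) (f n) (g n)) ⟩
    ∣ (f m ℚ.- f n) ℚ.+ (g m ℚ.- g n) ∣
      ≤⟨ ℚ.∣p+q∣≤∣p∣+∣q∣ (f m ℚ.- f n) (g m ℚ.- g n) ⟩
    ∣ f m ℚ.- f n ∣ ℚ.+ ∣ g m ℚ.- g n ∣
      ≤⟨ ℚ.+-mono-≤ (hf (ℕ.m⊔n≤o⇒m≤o M N ≤m) (ℕ.m⊔n≤o⇒m≤o M N ≤n))
                    (hg (ℕ.m⊔n≤o⇒n≤o M N ≤m) (ℕ.m⊔n≤o⇒n≤o M N ≤n)) ⟩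
    ½ ℚ.* ε ℚ.+ ½ ℚ.* ε
      ≡⟨ half+half ε ⟩
    ε ∎
    where
    open ℚ.≤-Reasoning
    open +-*-Solver
    rearrange : ∀ a b c d → (a ℚ.+ b) ℚ.- (c ℚ.+ d) ≡ (a ℚ.- c) ℚ.+ (b ℚ.- d)
    rearrange = solve 4 (λ a b c d → (a :+ b) :- (c :+ d) := (a :- c) :+ (b :- d)) refl

  neg-cauchy : ∀ {f} → Cauchy f → Cauchy (λ n → ℚ.- f n)
  neg-cauchy {f} cf ε 0<ε with cf ε 0<ε
  ... | N , hf = N , λ {m} {n} ≤m ≤n →
    subst (ℚ._≤ ε)
      (trans (sym (ℚ.∣-p∣≡∣p∣ (f m ℚ.- f n)))
             (cong ∣_∣ (ℚ.neg-distrib-+ (f m) (ℚ.- f n))))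
      (hf ≤m ≤n)

  EventuallyBounded : (ℕ → ℚ) → Set
  EventuallyBounded f =
    ∃[ B ] (0ℚ ℚ.< B × ∃[ N ] (∀ {n} → N ℕ.≤ n → ∣ f n ∣ ℚ.≤ B))

  cauchy⇒bounded : ∀ {f} → Cauchy f → EventuallyBounded f
  cauchy⇒bounded {f} cf with cf 1ℚ (toWitness {a? = 0ℚ ℚ.<? 1ℚ} _)
  ... | N , hf =
    1ℚ ℚ.+ ∣ f N ∣ ,
    ℚ.+-mono-<-≤ (toWitness {a? = 0ℚ ℚ.<? 1ℚ} _) (ℚ.0≤∣p∣ (f N)) ,
    N , λ {n} ≤n → begin
      ∣ f n ∣                         ≡⟨ cong ∣_∣ (split (f n) (f N)) ⟩
      ∣ (f n ℚ.- f N) ℚ.+ f N ∣       ≤⟨ ℚ.∣p+q∣≤∣p∣+∣q∣ (f n ℚ.- f N) (f N) ⟩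
      ∣ f n ℚ.- f N ∣ ℚ.+ ∣ f N ∣     ≤⟨ ℚ.+-monoˡ-≤ ∣ f N ∣ (hf ≤n ℕ.≤-refl) ⟩
      1ℚ ℚ.+ ∣ f N ∣                  ∎
    where
    open ℚ.≤-Reasoning
    open +-*-Solver
    split : ∀ a b → a ≡ (a ℚ.- b) ℚ.+ b
    split = solve 2 (λ a b → a := (a :- b) :+ b) refl

  *-cauchy : ∀ {f g} → Cauchy f → Cauchy g → Cauchy (λ n → f n ℚ.* g n)
  *-cauchy {f} {g} cf cg ε 0<ε = N , λ {m} {n} ≤m ≤n → begin
      ∣ f m ℚ.* g m ℚ.- f n ℚ.* g n ∣
        ≡⟨ cong ∣_∣ (rearrange (f m) (g m) (f n) (g n)) ⟩
      ∣ f m ℚ.* (g m ℚ.- g n) ℚ.+ g n ℚ.* (f m ℚ.- f n) ∣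
        ≤⟨ ℚ.∣p+q∣≤∣p∣+∣q∣ (f m ℚ.* (g m ℚ.- g n)) (g n ℚ.* (f m ℚ.- f n)) ⟩
      ∣ f m ℚ.* (g m ℚ.- g n) ∣ ℚ.+ ∣ g n ℚ.* (f m ℚ.- f n) ∣
        ≤⟨ ℚ.+-mono-≤
             (*-bound (f m) (g m ℚ.- g n) 0<Bf (hBf (N≥₁ ≤m)) (hg (N≥₄ ≤m) (N≥₄ ≤n)))
             (*-bound (g n) (f m ℚ.- f n) 0<Bg (hBg (N≥₂ ≤n)) (hf (N≥₃ ≤m) (N≥₃ ≤n))) ⟩
      Bf ℚ.* δ ℚ.+ Bg ℚ.* δ
        ≡⟨ ℚ.*-distribʳ-+ δ Bf Bg ⟨
      B ℚ.* (1/ B ℚ.* ε)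
        ≡⟨ ℚ.*-assoc B (1/ B) ε ⟨
      (B ℚ.* 1/ B) ℚ.* ε
        ≡⟨ cong (ℚ._* ε) (ℚ.*-inverseʳ B) ⟩
      1ℚ ℚ.* ε
        ≡⟨ ℚ.*-identityˡ ε ⟩
      ε ∎
    where
    open ℚ.≤-Reasoning

    rearrange : ∀ a b c d →
      a ℚ.* b ℚ.- c ℚ.* d ≡ a ℚ.* (b ℚ.- d) ℚ.+ d ℚ.* (a ℚ.- c)
    rearrange = solve 4 (λ a b c d →
      a :* b :- c :* d := a :* (b :- d) :+ d :* (a :- c)) refl
      where open +-*-Solver

    *-bound : ∀ p q {P Q} → 0ℚ ℚ.< P → ∣ p ∣ ℚ.≤ P → ∣ q ∣ ℚ.≤ Q →
              ∣ p ℚ.* q ∣ ℚ.≤ P ℚ.* Q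
    *-bound p q {P} {Q} 0<P p≤P q≤Q = begin
      ∣ p ℚ.* q ∣       ≡⟨ ℚ.∣p*q∣≡∣p∣*∣q∣ p q ⟩
      ∣ p ∣ ℚ.* ∣ q ∣   ≤⟨ ℚ.*-monoʳ-≤-nonNeg ∣ q ∣ {{ℚ.nonNegative (ℚ.0≤∣p∣ q)}} p≤P ⟩
      P ℚ.* ∣ q ∣       ≤⟨ ℚ.*-monoˡ-≤-nonNeg P {{ℚ.nonNegative (ℚ.<⇒≤ 0<P)}} q≤Q ⟩
      P ℚ.* Q           ∎

    bf = cauchy⇒bounded cf
    bg = cauchy⇒bounded cg
    Bf = proj₁ bf
    Bg = proj₁ bg
    0<Bf = proj₁ (proj₂ bf)
    0<Bg = proj₁ (proj₂ bg)
    N₁ = proj₁ (proj₂ (proj₂ bf))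
    N₂ = proj₁ (proj₂ (proj₂ bg))
    hBf : ∀ {n} → N₁ ℕ.≤ n → ∣ f n ∣ ℚ.≤ Bf
    hBf = proj₂ (proj₂ (proj₂ bf))
    hBg : ∀ {n} → N₂ ℕ.≤ n → ∣ g n ∣ ℚ.≤ Bg
    hBg = proj₂ (proj₂ (proj₂ bg))

    B = Bf ℚ.+ Bg

    instance
      B-pos : ℚ.Positive B
      B-pos = ℚ.positive (ℚ.+-mono-< 0<Bf 0<Bg)

      B-nonZero : ℚ.NonZero B
      B-nonZero = ℚ.pos⇒nonZero B

      1/B-pos : ℚ.Positive (1/ B)
      1/B-pos = ℚ.1/pos⇒pos B

    δ = 1/ B ℚ.* ε

    0<δ : 0ℚ ℚ.< δ
    0<δ = subst (ℚ._< δ) (ℚ.*-zeroʳ (1/ B)) (ℚ.*-monoʳ-<-pos (1/ B) 0<ε)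

    N₃ = proj₁ (cf δ 0<δ)
    N₄ = proj₁ (cg δ 0<δ)
    hf : ∀ {m n} → N₃ ℕ.≤ m → N₃ ℕ.≤ n → ∣ f m ℚ.- f n ∣ ℚ.≤ δ
    hf = proj₂ (cf δ 0<δ)
    hg : ∀ {m n} → N₄ ℕ.≤ m → N₄ ℕ.≤ n → ∣ g m ℚ.- g n ∣ ℚ.≤ δ
    hg = proj₂ (cg δ 0<δ)

    N = (N₁ ℕ.⊔ N₂) ℕ.⊔ (N₃ ℕ.⊔ N₄)

    N≥₁ : ∀ {n} → N ℕ.≤ n → N₁ ℕ.≤ n
    N≥₁ = ℕ.m⊔n≤o⇒m≤o N₁ N₂ ∘ ℕ.m⊔n≤o⇒m≤o (N₁ ℕ.⊔ N₂) (N₃ ℕ.⊔ N₄)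
    N≥₂ : ∀ {n} → N ℕ.≤ n → N₂ ℕ.≤ n
    N≥₂ = ℕ.m⊔n≤o⇒n≤o N₁ N₂ ∘ ℕ.m⊔n≤o⇒m≤o (N₁ ℕ.⊔ N₂) (N₃ ℕ.⊔ N₄)
    N≥₃ : ∀ {n} → N ℕ.≤ n → N₃ ℕ.≤ n
    N≥₃ = ℕ.m⊔n≤o⇒m≤o N₃ N₄ ∘ ℕ.m⊔n≤o⇒n≤o (N₁ ℕ.⊔ N₂) (N₃ ℕ.⊔ N₄)
    N≥₄ : ∀ {n} → N ℕ.≤ n → N₄ ℕ.≤ n
    N≥₄ = ℕ.m⊔n≤o⇒n≤o N₃ N₄ ∘ ℕ.m⊔n≤o⇒n≤o (N₁ ℕ.⊔ N₂) (N₃ ℕ.⊔ N₄)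

infixl 6 _+_
infixl 7 _*_
infix  8 -_

fromℚ : ℚ → ℝ
fromℚ q = mkℝ (λ _ → q) (const-cauchy q)

0ℝ 1ℝ : ℝ
0ℝ = fromℚ 0ℚ
1ℝ = fromℚ 1ℚ

_+_ _*_ : ℝ → ℝ → ℝ
x + y = mkℝ (λ n → seq x n ℚ.+ seq y n) (+-cauchy {seq x} {seq y} (cauchy x) (cauchy y))
x * y = mkℝ (λ n → seq x n ℚ.* seq y n) (*-cauchy {seq x} {seq y} (cauchy x) (cauchy y))

-_ : ℝ → ℝ
- x = mkℝ (λ n → ℚ.- seq x n) (neg-cauchy {seq x} (cauchy x))

ℝ-rawRing : RawRing 0ℓ 0ℓ
ℝ-rawRing = record
  { Carrier = ℝ ; _≈_ = _≈_ ; _+_ = _+_ ; _*_ = _*_ ; -_ = -_ ; 0# = 0ℝ ; 1# = 1ℝ }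

module _ {c ℓ} (R : RawRing c ℓ) where
  private
    module R = RawRing R
    open RawSemiringOps R.rawSemiring using (sum; _^_)

  Matrix : ℕ → Set c
  Matrix n = Fin n → Fin n → R.Carrier

  det : ∀ {n} → Matrix n → R.Carrier
  det {ℕ.zero} A = R.1#
  det {suc n}  A = sum λ j →
    ((R.- R.1#) ^ toℕ j) R.* (A Fin.zero j R.* det (λ i k → A (Fin.suc i) (punchIn j k)))

  identity : ∀ {n} → Matrix n
  identity i j = if does (i Fin.≟ j) then R.1# else R.0#

  charPoly : ∀ {n} → Matrix n → R.Carrier → R.Carrier
  charPoly A x = det λ i j → (x R.* identity i j) R.+ (R.- A i j)

open RawSemiringOps (RawRing.rawSemiring ℝ-rawRing) using (product)

-- The entries of λs are all the eigenvalues of A, repeated according to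
-- multiplicity: det (x I − A) = ∏ᵢ (x − λᵢ) for every real x.  (As ℝ is
-- infinite, this is the same as an identity of polynomials.)
IsSpectrum : ∀ {n} → Matrix ℝ-rawRing n → Vec ℝ n → Set
IsSpectrum A λs = ∀ x → charPoly ℝ-rawRing A x ≈ product (λ i → x + (- lookupᵛ λs i))

-- SignCount λs p z m: among the entries of λs, exactly p are positive,
-- z are zero and m are negative.  A relation, since the sign of a real
-- number is not computable.
data SignCount : ∀ {n} → Vec ℝ n → ℕ → ℕ → ℕ → Set where
  []   : SignCount [] 0 0 0
  pos  : ∀ {n x p z m} {xs : Vec ℝ n} →
         0ℝ < x → SignCount xs p z m → SignCount (x ∷ xs) (suc p) z m
  zero : ∀ {n x p z m} {xs : Vec ℝ n} →
         x ≈ 0ℝ → SignCount xs p z m → SignCount (x ∷ xs) p (suc z) m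
  neg  : ∀ {n x p z m} {xs : Vec ℝ n} →
         x < 0ℝ → SignCount xs p z m → SignCount (x ∷ xs) p z (suc m)

record Graph : Set₁ where
  field
    order  : ℕ
    _~_    : Rel (Fin order) 0ℓ
    _~?_   : Decidable _~_
    sym-~  : Symmetric _~_
    irrefl : Irreflexive _≡_ _~_

  Connected : Set
  Connected = ℕ.NonZero order × (∀ i j → Star _~_ i j)

  adjacency : Matrix ℝ-rawRing order
  adjacency i j = if does (i ~? j) then 1ℝ else 0ℝ

  edges : List (Fin order × Fin order)
  edges = filter (λ (i , j) → (i Fin.<? j) ×-dec (i ~? j))
                 (cartesianProduct (allFin order) (allFin order))

-- HasInertia H (n⁺ , n⁰ , n⁻) says In H = (n⁺ , n⁰ , n⁻).  A monic real
-- polynomial determines its roots, so at most one triple qualifies.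
HasInertia : Graph → ℕ × ℕ × ℕ → Set
HasInertia H (n⁺ , n⁰ , n⁻) =
  ∃[ λs ] (IsSpectrum (Graph.adjacency H) λs × SignCount λs n⁺ n⁰ n⁻)

HasSignature : Graph → ℤ → Set
HasSignature H s = ∃[ n⁺ ] ∃[ n⁰ ] ∃[ n⁻ ] (HasInertia H (n⁺ , n⁰ , n⁻) × s ≡ n⁺ ⊖ n⁻)

module _ {n : ℕ} where

  ShareEndpoint : Rel (Fin n × Fin n) 0ℓ
  ShareEndpoint (i , j) (k , l) = (i ≡ k ⊎ i ≡ l) ⊎ (j ≡ k ⊎ j ≡ l)

  shareEndpoint? : Decidable ShareEndpoint
  shareEndpoint? (i , j) (k , l) =
    ((i Fin.≟ k) ⊎-dec (i Fin.≟ l)) ⊎-dec ((j Fin.≟ k) ⊎-dec (j Fin.≟ l))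

  shareEndpoint-sym : Symmetric ShareEndpoint
  shareEndpoint-sym (inj₁ (inj₁ p)) = inj₁ (inj₁ (sym p))
  shareEndpoint-sym (inj₁ (inj₂ p)) = inj₂ (inj₁ (sym p))
  shareEndpoint-sym (inj₂ (inj₁ p)) = inj₁ (inj₂ (sym p))
  shareEndpoint-sym (inj₂ (inj₂ p)) = inj₂ (inj₂ (sym p))

-- The vertices are the positions in the duplicate-free list of edges, so
-- e ≢ f says that the edges themselves are distinct.
lineGraph : Graph → Graph
lineGraph G = record
  { order  = length edges
  ; _~_    = λ e f → e ≢ f × ShareEndpoint (lookup edges e) (lookup edges f)
  ; _~?_   = λ e f → ¬? (e Fin.≟ f) ×-dec shareEndpoint? (lookup edges e) (lookup edges f)
  ; sym-~  = λ (e≢f , s) → (e≢f ∘ sym) , shareEndpoint-sym s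
  ; irrefl = λ e≡f (e≢f , _) → e≢f e≡f
  }
  where open Graph G

module G₁₄ where

  Vertex : Set
  Vertex = Fin 14

  a b c d : Vertex
  a = # 0
  b = # 1
  c = # 2
  d = # 3

  u v : Fin 5 → Vertex
  u i = 4 ↑ʳ (i ↑ˡ 5)
  v i = 9 ↑ʳ i

  edgeList : List (Vertex × Vertex)
  edgeList =
      (a , b) ∷ (b , c) ∷ (c , d) ∷ (d , a)
    ∷ (u (# 0) , u (# 1)) ∷ (u (# 1) , u (# 2)) ∷ (u (# 2) , u (# 3))
    ∷ (u (# 3) , u (# 4)) ∷ (u (# 4) , u (# 0))
    ∷ (v (# 0) , v (# 1)) ∷ (v (# 1) , v (# 2)) ∷ (v (# 2) , v (# 3))
    ∷ (v (# 3) , v (# 4)) ∷ (v (# 4) , v (# 0))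
    ∷ (a , u (# 0)) ∷ (b , v (# 0)) ∷ []

  open DecMembership (×-≡-dec (Fin._≟_ {14}) (Fin._≟_ {14})) using (_∈_; _∈?_)

  Adjacent : Rel Vertex 0ℓ
  Adjacent i j = (i , j) ∈ edgeList ⊎ (j , i) ∈ edgeList

  adjacent? : Decidable Adjacent
  adjacent? i j = ((i , j) ∈? edgeList) ⊎-dec ((j , i) ∈? edgeList)

  irreflexive : Irreflexive _≡_ Adjacent
  irreflexive {i} refl = toWitness {a? = Fin.all? (λ i → ¬? (adjacent? i i))} _ i

G₁₄ : Graph
G₁₄ = record
  { order  = 14
  ; _~_    = G₁₄.Adjacent
  ; _~?_   = G₁₄.adjacent?
  ; sym-~  = swap
  ; irrefl = G₁₄.irreflexive
  }

{-# OPTIONS --safe #-}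

-- Over ℤ[x] the characteristic polynomial of L(G₁₄) factors as C D with C and D squarefree.
-- Disjoint rational intervals at whose end points C (resp. D) changes sign contain 3 (resp. 13)
-- real roots, found by bisection.  Differences of roots from distinct intervals are bounded away
-- from 0, hence cancellable, and so the factor theorem splits C and D into linear factors over
-- the Cauchy reals without any division.  The signs of the eigenvalues are those of the intervals.

module Submission where

open import Defs using (Graph; G₁₄; lineGraph; HasInertia; HasSignature)
open import Defs using (Matrix; det; identity; charPoly; shareEndpoint?; IsSpectrum; SignCount)
open import Algebra.Bundles using (CommutativeMonoid; CommutativeRing)
open import Algebra.Bundles.Raw using (RawRing)
import Algebra.Definitions.RawSemiring as RawSemiringOps
open import Algebra.Morphism.Structures using (module RingMorphisms)
import Algebra.Properties.Monoid.Sum as MonoidSum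
import Algebra.Properties.Ring as RingProperties
import Algebra.Properties.Semiring.Sum as SemiringSum
import Algebra.Solver.Ring.NaturalCoefficients.Default as SemiringSolver
open import Algebra.Structures using (IsCommutativeRing)
open import Data.Bool.Base using (true; false; if_then_else_)
open import Data.Fin.Base as Fin using (Fin; zero; suc; toℕ; punchIn)
open import Data.Fin.Induction using (<-wellFounded)
import Data.Fin.Properties as Fin
open import Data.Integer.Base as ℤ using (ℤ; +_; -[1+_]; 0ℤ; 1ℤ)
import Data.Integer.Properties as ℤ
open import Data.List.Base as List using (List; []; _∷_; foldr; length; lookup)
import Data.List.Properties as List
open import Data.Maybe.Base using (Maybe; just; nothing)
open import Data.Nat.Base as ℕ using (ℕ; zero; suc; ≤′-reflexive; ≤′-step)
import Data.Nat.Properties as ℕ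
open import Data.Product.Base using (_×_; _,_; ∃-syntax; proj₁; proj₂)
open import Data.Rational.Base as ℚ using (ℚ; 0ℚ; 1ℚ; ½; ∣_∣; 1/_; *≤*)
open import Data.Rational.Literals using (fromℤ)
import Data.Rational.Properties as ℚ
open import Data.Rational.Solver using (module +-*-Solver)
import Data.Rational.Unnormalised.Base as ℚᵘ
import Data.Rational.Unnormalised.Properties as ℚᵘ
open import Data.Sum.Base using (_⊎_; inj₁; inj₂)
open import Data.Vec.Base as Vec using (Vec; []; _∷_; _++_; tabulate; removeAt)
  renaming (lookup to lookupᵛ)
import Data.Vec.Properties as Vec
open import Data.Vec.Relation.Binary.Pointwise.Inductive as Pointwise using (Pointwise; []; _∷_)
open import Data.Vec.Relation.Unary.All as All using (All; []; _∷_)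
open import Data.Vec.Relation.Unary.AllPairs as AllPairs using (AllPairs; []; _∷_)
open import Function.Base using (_∘_)
open import Induction.WellFounded using (Acc; acc)
open import Level using (0ℓ; _⊔_)
open import Relation.Binary.Construct.Closure.ReflexiveTransitive as Star using (Star; _◅_; _◅◅_)
open import Relation.Binary.Core using (Rel)
open import Relation.Binary.Definitions using (Symmetric)
open import Relation.Binary.PropositionalEquality as ≡ using (_≡_)
open import Relation.Nullary.Decidable
  using (Dec; yes; no; does; ¬?; _×-dec_; _⊎-dec_; from-yes)
open import Relation.Nullary.Negation.Core using (¬_)
open Graph using (edges; Connected)

-- The determinant of the statement is a Laplace expansion with 16! terms over reals whose equality
-- is undecidable, so it is never evaluated. Merged minors are computed once over `ℤ[X]`, and
-- evaluation at an arbitrary real, being a ring homomorphism, carries the result over. One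
-- squarefree factor would not do: a double root produces no sign change, and its two copies have no
-- cancellable difference. The repeated eigenvalues have structural origins. In the line graph of a
-- connected non-bipartite graph, -2 has multiplicity |E| - |V|, here 2. On each pentagon, the edge
-- vectors that are odd under the reflection fixing the attaching vertex, extended by 0, form an
-- invariant plane with characteristic polynomial x² + x - 1, so that factor occurs twice. The order
-- of the Cauchy reals is undecidable as well. Bisection still works because it tests signs at
-- rational points only, where the value of an integer polynomial is a rational number.

-- Integer polynomials, constant coefficient first

-- Drops the trailing zeros, so that [] is the only representation of 0.
infixr 5 _∷₀_
_∷₀_ : ℤ → List ℤ → List ℤ
+ 0 ∷₀ []    = []
c   ∷₀ p     = c ∷ p

addᴾ : List ℤ → List ℤ → List ℤ
addᴾ []      q       = q
addᴾ (a ∷ p) []      = a ∷ p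
addᴾ (a ∷ p) (b ∷ q) = a ℤ.+ b ∷₀ addᴾ p q

scaleᴾ : ℤ → List ℤ → List ℤ
scaleᴾ a = foldr (λ b p → a ℤ.* b ∷₀ p) []

mulᴾ : List ℤ → List ℤ → List ℤ
mulᴾ []      q = []
mulᴾ (a ∷ p) q = addᴾ (scaleᴾ a q) (0ℤ ∷₀ mulᴾ p q)

-- Raw, with propositional equality: polynomials are compared by computation, and ring laws are
-- invoked only after evaluation in a commutative ring.
ℤ[X] : RawRing 0ℓ 0ℓ
ℤ[X] = record
  { Carrier = List ℤ ; _≈_ = _≡_ ; _+_ = addᴾ ; _*_ = mulᴾ
  ; -_ = List.map (ℤ.-_) ; 0# = [] ; 1# = 1ℤ ∷ [] }

X : List ℤ
X = 0ℤ ∷ 1ℤ ∷ []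

-- Evaluation of integer polynomials in a commutative ring

module _ {c ℓ} (R : CommutativeRing c ℓ) where

  open CommutativeRing R hiding (zero)

  open import Relation.Binary.Reasoning.Setoid setoid
  open SemiringSum semiring using (sum-cong-≋; *-distribˡ-sum; sum)
  open RingProperties ring using (-0#≈0#; -‿distribʳ-*; -‿+-comm)
  open SemiringSolver commutativeSemiring using (solve; _:=_; _:+_; _:*_; con)
  open RawSemiringOps (RawRing.rawSemiring rawRing) using (_^_)

  eval : List Carrier → Carrier → Carrier
  eval []      x = 0#
  eval (c ∷ p) x = c + x * eval p x

  open RingMorphisms ℤ.+-*-rawRing rawRing using () renaming (IsRingHomomorphism to ℤ-Hom)
  open RingMorphisms ℤ[X] rawRing using () renaming (IsRingHomomorphism to ℤ[X]-Hom)

  module _ {ι : ℤ → Carrier} (ι-hom : ℤ-Hom ι) where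

    private
      module ι = ℤ-Hom ι-hom

    ⟦_⟧ : List ℤ → Carrier → Carrier
    ⟦ p ⟧ = eval (List.map ι p)

    module _ (x : Carrier) where

      ∷₀-homo : ∀ c p → ⟦ c ∷₀ p ⟧ x ≈ ι c + x * ⟦ p ⟧ x
      ∷₀-homo (+ 0)            []      = sym (trans (+-cong ι.0#-homo (zeroʳ x)) (+-identityˡ 0#))
      ∷₀-homo (+ 0)            (_ ∷ _) = refl
      ∷₀-homo (+ suc _)        p       = refl
      ∷₀-homo -[1+ _ ]         p       = refl

      addᴾ-homo : ∀ p q → ⟦ addᴾ p q ⟧ x ≈ ⟦ p ⟧ x + ⟦ q ⟧ x
      addᴾ-homo []      q       = sym (+-identityˡ _)
      addᴾ-homo (a ∷ p) []      = sym (+-identityʳ _)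
      addᴾ-homo (a ∷ p) (b ∷ q) = begin
        ⟦ a ℤ.+ b ∷₀ addᴾ p q ⟧ x
          ≈⟨ ∷₀-homo (a ℤ.+ b) (addᴾ p q) ⟩
        ι (a ℤ.+ b) + x * ⟦ addᴾ p q ⟧ x
          ≈⟨ +-cong (ι.+-homo a b) (*-congˡ (addᴾ-homo p q)) ⟩
        (ι a + ι b) + x * (⟦ p ⟧ x + ⟦ q ⟧ x)
          ≈⟨ rearrange (ι a) (ι b) x (⟦ p ⟧ x) (⟦ q ⟧ x) ⟩
        (ι a + x * ⟦ p ⟧ x) + (ι b + x * ⟦ q ⟧ x) ∎
        where
        rearrange : ∀ a b x p q → (a + b) + x * (p + q) ≈ (a + x * p) + (b + x * q)
        rearrange = solve 5 (λ a b x p q →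
          (a :+ b) :+ x :* (p :+ q) := (a :+ x :* p) :+ (b :+ x :* q)) refl

      scaleᴾ-homo : ∀ a q → ⟦ scaleᴾ a q ⟧ x ≈ ι a * ⟦ q ⟧ x
      scaleᴾ-homo a []      = sym (zeroʳ _)
      scaleᴾ-homo a (b ∷ q) = begin
        ⟦ a ℤ.* b ∷₀ scaleᴾ a q ⟧ x
          ≈⟨ ∷₀-homo (a ℤ.* b) (scaleᴾ a q) ⟩
        ι (a ℤ.* b) + x * ⟦ scaleᴾ a q ⟧ x
          ≈⟨ +-cong (ι.*-homo a b) (*-congˡ (scaleᴾ-homo a q)) ⟩
        ι a * ι b + x * (ι a * ⟦ q ⟧ x)
          ≈⟨ rearrange (ι a) (ι b) x (⟦ q ⟧ x) ⟩
        ι a * (ι b + x * ⟦ q ⟧ x) ∎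
        where
        rearrange : ∀ a b x q → a * b + x * (a * q) ≈ a * (b + x * q)
        rearrange = solve 4 (λ a b x q →
          a :* b :+ x :* (a :* q) := a :* (b :+ x :* q)) refl

      mulᴾ-homo : ∀ p q → ⟦ mulᴾ p q ⟧ x ≈ ⟦ p ⟧ x * ⟦ q ⟧ x
      mulᴾ-homo []      q = sym (zeroˡ _)
      mulᴾ-homo (a ∷ p) q = begin
        ⟦ addᴾ (scaleᴾ a q) (0ℤ ∷₀ mulᴾ p q) ⟧ x
          ≈⟨ addᴾ-homo (scaleᴾ a q) (0ℤ ∷₀ mulᴾ p q) ⟩
        ⟦ scaleᴾ a q ⟧ x + ⟦ 0ℤ ∷₀ mulᴾ p q ⟧ x
          ≈⟨ +-cong (scaleᴾ-homo a q) (∷₀-homo 0ℤ (mulᴾ p q)) ⟩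
        ι a * ⟦ q ⟧ x + (ι 0ℤ + x * ⟦ mulᴾ p q ⟧ x)
          ≈⟨ +-congˡ (+-cong ι.0#-homo (*-congˡ (mulᴾ-homo p q))) ⟩
        ι a * ⟦ q ⟧ x + (0# + x * (⟦ p ⟧ x * ⟦ q ⟧ x))
          ≈⟨ rearrange (ι a) x (⟦ p ⟧ x) (⟦ q ⟧ x) ⟩
        (ι a + x * ⟦ p ⟧ x) * ⟦ q ⟧ x ∎
        where
        rearrange : ∀ a x p q → a * q + (0# + x * (p * q)) ≈ (a + x * p) * q
        rearrange = solve 4 (λ a x p q →
          a :* q :+ (con 0 :+ x :* (p :* q)) := (a :+ x :* p) :* q) refl

      negᴾ-homo : ∀ p → ⟦ List.map (ℤ.-_) p ⟧ x ≈ - ⟦ p ⟧ x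
      negᴾ-homo []      = sym -0#≈0#
      negᴾ-homo (a ∷ p) = begin
        ι (ℤ.- a) + x * ⟦ List.map (ℤ.-_) p ⟧ x
          ≈⟨ +-cong (ι.-‿homo a) (*-congˡ (negᴾ-homo p)) ⟩
        - ι a + x * - ⟦ p ⟧ x
          ≈⟨ +-congˡ (-‿distribʳ-* x (⟦ p ⟧ x)) ⟨
        - ι a + - (x * ⟦ p ⟧ x)
          ≈⟨ -‿+-comm (ι a) (x * ⟦ p ⟧ x) ⟩
        - (ι a + x * ⟦ p ⟧ x) ∎

      -- Since `x` is arbitrary, a single computation over `ℤ[X]` gives the characteristic
      -- polynomial at every point of the ring.
      eval-hom : ℤ[X]-Hom (λ p → ⟦ p ⟧ x)
      eval-hom = record
        { isSemiringHomomorphism = record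
          { isNearSemiringHomomorphism = record
            { +-isMonoidHomomorphism = record
              { isMagmaHomomorphism = record
                { isRelHomomorphism = record { cong = λ { ≡.refl → refl } }
                ; homo = addᴾ-homo }
              ; ε-homo = refl }
            ; *-homo = mulᴾ-homo }
          ; 1#-homo = trans (+-cong ι.1#-homo (zeroʳ x)) (+-identityʳ 1#) }
        ; -‿homo = negᴾ-homo }

      ⟦X⟧ : ⟦ X ⟧ x ≈ x
      ⟦X⟧ = begin
        ι 0ℤ + x * (ι 1ℤ + x * 0#)  ≈⟨ +-cong ι.0#-homo (*-congˡ (+-congʳ ι.1#-homo)) ⟩
        0# + x * (1# + x * 0#)      ≈⟨ simplify x ⟩
        x                           ∎
        where
        simplify : ∀ x → 0# + x * (1# + x * 0#) ≈ x
        simplify = solve 1 (λ x →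
          con 0 :+ x :* (con 1 :+ x :* con 0) := x) refl

  det-cong : ∀ {n} {A B : Matrix rawRing n} → (∀ i j → A i j ≈ B i j) →
             det rawRing A ≈ det rawRing B
  det-cong {zero}  A≈B = refl
  det-cong {suc n} {A} {B} A≈B = sum-cong-≋ λ j →
    *-congˡ {((- 1#) ^ toℕ j)} (*-cong (A≈B zero j) (det-cong λ i k → A≈B (suc i) (punchIn j k)))

-- Determinants by merged Laplace expansion

lookup-removeAt : ∀ {a} {A : Set a} {n} (xs : Vec A (suc n)) i j →
                  lookupᵛ (removeAt xs i) j ≡ lookupᵛ xs (punchIn i j)
lookup-removeAt (x ∷ xs)     zero    j       = ≡.refl
lookup-removeAt (x ∷ y ∷ xs) (suc i) zero    = ≡.refl
lookup-removeAt (x ∷ y ∷ xs) (suc i) (suc j) = lookup-removeAt (y ∷ xs) i j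

module Minors {c ℓ} (S : RawRing c ℓ) (zero? : ∀ s → Maybe (RawRing._≈_ S s (RawRing.0# S))) where

  open RawRing S
  open RawSemiringOps rawSemiring using (_^_)

  -- Laplace expansion along the first row, carried out for all minors of a level at once: terms
  -- with the same remaining columns are merged, so a sparse matrix keeps few of them per row.

  Combination : ℕ → ℕ → Set c
  Combination n k = List (Carrier × Vec (Fin n) k)

  infixr 5 _⊕_
  _⊕_ : ∀ {n k} → Carrier × Vec (Fin n) k → Combination n k → Combination n k
  (p , cs) ⊕ L with zero? p
  -- Discarding zero terms is where sparsity pays. A one-sided test is enough: an undetected zero
  -- costs only time.
  ... | just _ = L
  (p , cs) ⊕ [] | nothing = (p , cs) ∷ []
  (p , cs) ⊕ ((q , ds) ∷ L) | nothing with Vec.≡-dec Fin._≟_ cs ds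
  ... | yes _ = (p + q , ds) ∷ L
  ... | no  _ = (q , ds) ∷ ((p , cs) ⊕ L)

  ⨁ : ∀ {n k m} → (Fin m → Carrier × Vec (Fin n) k) → Combination n k → Combination n k
  ⨁ {m = zero}  t L = L
  ⨁ {m = suc m} t L = t zero ⊕ ⨁ (t ∘ suc) L

  cofactorTerms : ∀ {n k} → Vec Carrier n → Carrier × Vec (Fin n) (suc k) →
                  Fin (suc k) → Carrier × Vec (Fin n) k
  cofactorTerms row (p , cs) j = lookupᵛ row (lookupᵛ cs j) * ((- 1#) ^ toℕ j * p) , removeAt cs j

  expand : ∀ {n k} → Vec Carrier n → Combination n (suc k) → Combination n k
  expand row []      = []
  expand row (t ∷ L) = ⨁ (cofactorTerms row t) (expand row L)

  total : ∀ {n} → Combination n 0 → Carrier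
  total []            = 0#
  total ((p , _) ∷ L) = p + total L

  expandAll : ∀ {n k} → Vec (Vec Carrier n) k → Combination n k → Carrier
  expandAll []           L = total L
  expandAll (row ∷ rows) L = expandAll rows (expand row L)

  mergedDet : ∀ {n} → Matrix S n → Carrier
  mergedDet A = expandAll (tabulate (λ i → tabulate (A i))) ((1# , Vec.allFin _) ∷ [])

zeroᴾ? : (p : List ℤ) → Maybe (p ≡ [])
zeroᴾ? []      = just ≡.refl
zeroᴾ? (_ ∷ _) = nothing

charMatrix : ∀ {n} → Matrix ℤ[X] n → Matrix ℤ[X] n
charMatrix A i j = addᴾ (mulᴾ X (identity ℤ[X] i j)) (List.map (ℤ.-_) (A i j))

-- Uses the same adjacency test as `lineGraph`, so that over `ℝ` it agrees with `adjacency` by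
-- `refl`, while over `ℤ[X]` it can be computed with.
lineMatrix : ∀ {c ℓ} (S : RawRing c ℓ) {n} (es : List (Fin n × Fin n)) → Matrix S (length es)
lineMatrix S es e f =
  if does (¬? (e Fin.≟ f) ×-dec shareEndpoint? (lookup es e) (lookup es f))
  then RawRing.1# S else RawRing.0# S

-- Correctness of the merged expansion

module MinorsHomo {c ℓ c′ ℓ′} (S : RawRing c ℓ)
  (zero? : ∀ s → Maybe (RawRing._≈_ S s (RawRing.0# S)))
  (R : CommutativeRing c′ ℓ′)
  {⟦_⟧ : RawRing.Carrier S → CommutativeRing.Carrier R}
  (hom : RingMorphisms.IsRingHomomorphism S (CommutativeRing.rawRing R) ⟦_⟧) where

  open Minors S zero?
  private
    module S = RawRing S
    module S^ = RawSemiringOps S.rawSemiring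
    module ⟦⟧ = RingMorphisms.IsRingHomomorphism hom

  open CommutativeRing R hiding (zero)
  open import Relation.Binary.Reasoning.Setoid setoid
  open SemiringSum semiring using (sum-cong-≋; *-distribˡ-sum; sum)
  open SemiringSolver commutativeSemiring using (solve; _:=_; _:+_; _:*_)
  open RawSemiringOps (RawRing.rawSemiring rawRing) using (_^_)

  minor : ∀ {n k} → Vec (Vec S.Carrier n) k → Vec (Fin n) k → Carrier
  minor rows cs = det rawRing (λ i j → ⟦ lookupᵛ (lookupᵛ rows i) (lookupᵛ cs j) ⟧)

  term : ∀ {n k} → Vec (Vec S.Carrier n) k → S.Carrier × Vec (Fin n) k → Carrier
  term rows (p , cs) = ⟦ p ⟧ * minor rows cs

  -- The invariant of the expansion: `rows` are the rows still to be expanded. It starts as the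
  -- determinant, `expand` preserves it, and with no rows left it is the sum of the coefficients.
  value : ∀ {n k} → Vec (Vec S.Carrier n) k → Combination n k → Carrier
  value rows []      = 0#
  value rows (t ∷ L) = term rows t + value rows L

  ⊕-value : ∀ {n k} (rows : Vec (Vec S.Carrier n) k) t L →
            value rows (t ⊕ L) ≈ term rows t + value rows L
  ⊕-value rows (p , cs) L with zero? p
  ⊕-value rows (p , cs) L | just p≈0 = begin
    value rows L                       ≈⟨ +-identityˡ _ ⟨
    0# + value rows L                  ≈⟨ +-congʳ (zeroˡ (minor rows cs)) ⟨
    0# * minor rows cs + value rows L  ≈⟨ +-congʳ (*-congʳ (trans (⟦⟧.⟦⟧-cong p≈0) ⟦⟧.0#-homo)) ⟨
    ⟦ p ⟧ * minor rows cs + value rows L  ∎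
  ⊕-value rows (p , cs) [] | nothing = refl
  ⊕-value rows (p , cs) ((q , ds) ∷ L) | nothing with Vec.≡-dec Fin._≟_ cs ds
  ... | yes ≡.refl = begin
    ⟦ p S.+ q ⟧ * M + V          ≈⟨ +-congʳ (*-congʳ (⟦⟧.+-homo p q)) ⟩
    (⟦ p ⟧ + ⟦ q ⟧) * M + V      ≈⟨ +-congʳ (distribʳ M ⟦ p ⟧ ⟦ q ⟧) ⟩
    (⟦ p ⟧ * M + ⟦ q ⟧ * M) + V  ≈⟨ +-assoc _ _ _ ⟩
    ⟦ p ⟧ * M + (⟦ q ⟧ * M + V)  ∎
    where
    M = minor rows cs
    V = value rows L
  ... | no _ = begin
    s + value rows ((p , cs) ⊕ L)  ≈⟨ +-congˡ (⊕-value rows (p , cs) L) ⟩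
    s + (t + V)                    ≈⟨ solve 3 (λ s t V → s :+ (t :+ V) := t :+ (s :+ V)) refl s t V ⟩
    t + (s + V)                    ∎
    where
    s = term rows (q , ds)
    t = term rows (p , cs)
    V = value rows L

  ⨁-value : ∀ {n k m} (rows : Vec (Vec S.Carrier n) k) (t : Fin m → _) L →
            value rows (⨁ t L) ≈ sum (term rows ∘ t) + value rows L
  ⨁-value {m = zero}  rows t L = sym (+-identityˡ _)
  ⨁-value {m = suc m} rows t L = begin
    value rows (t zero ⊕ ⨁ (t ∘ suc) L)
      ≈⟨ ⊕-value rows (t zero) (⨁ (t ∘ suc) L) ⟩
    term rows (t zero) + value rows (⨁ (t ∘ suc) L)
      ≈⟨ +-congˡ (⨁-value rows (t ∘ suc) L) ⟩
    term rows (t zero) + (sum (term rows ∘ t ∘ suc) + value rows L)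
      ≈⟨ +-assoc _ _ _ ⟨
    sum (term rows ∘ t) + value rows L ∎

  sign-homo : ∀ j → ⟦ (S.- S.1#) S^.^ j ⟧ ≈ (- 1#) ^ j
  sign-homo zero    = ⟦⟧.1#-homo
  sign-homo (suc j) = trans (⟦⟧.*-homo _ _)
    (*-cong (trans (⟦⟧.-‿homo S.1#) (-‿cong ⟦⟧.1#-homo)) (sign-homo j))

  -- The recursion defining `det`, with the coefficient `p` moved out of the sum; the last
  -- expression of the chain unfolds to the right-hand side.
  term-expand : ∀ {n k} (row : Vec S.Carrier n) (rows : Vec (Vec S.Carrier n) k) p cs →
    sum (term rows ∘ cofactorTerms row (p , cs))
      ≈ term (row ∷ rows) (p , cs)
  term-expand row rows p cs = begin
    sum (λ j → ⟦ e j S.* (σ j S.* p) ⟧ * minor rows (removeAt cs j))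
      ≈⟨ sum-cong-≋ (λ j → begin
           ⟦ e j S.* (σ j S.* p) ⟧ * minor rows (removeAt cs j)
             ≈⟨ *-cong
                  (trans (⟦⟧.*-homo (e j) _)
                    (*-congˡ (trans (⟦⟧.*-homo (σ j) p) (*-congʳ (sign-homo (toℕ j))))))
                  -- Two ways of deleting a column meet here: `removeAt` on the list of remaining
                  -- columns and `punchIn` on positions.
                  (det-cong R λ i k → reflexive
                    (≡.cong (λ c → ⟦ lookupᵛ (lookupᵛ rows i) c ⟧) (lookup-removeAt cs j k))) ⟩
           (⟦ e j ⟧ * ((- 1#) ^ toℕ j * ⟦ p ⟧)) * δ j
             ≈⟨ solve 4 (λ e s p d → (e :* (s :* p)) :* d := p :* (s :* (e :* d))) refl
                  ⟦ e j ⟧ ((- 1#) ^ toℕ j) ⟦ p ⟧ (δ j) ⟩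
           ⟦ p ⟧ * ((- 1#) ^ toℕ j * (⟦ e j ⟧ * δ j)) ∎) ⟩
    sum (λ j → ⟦ p ⟧ * ((- 1#) ^ toℕ j * (⟦ e j ⟧ * δ j)))
      ≈⟨ *-distribˡ-sum ⟦ p ⟧ (λ j → (- 1#) ^ toℕ j * (⟦ e j ⟧ * δ j)) ⟨
    ⟦ p ⟧ * sum (λ j → (- 1#) ^ toℕ j * (⟦ e j ⟧ * δ j)) ∎
    where
    e = λ j → lookupᵛ row (lookupᵛ cs j)
    σ = λ j → (S.- S.1#) S^.^ toℕ j
    δ = λ j → det rawRing (λ i k → ⟦ lookupᵛ (lookupᵛ rows i) (lookupᵛ cs (punchIn j k)) ⟧)

  expand-value : ∀ {n k} (row : Vec S.Carrier n) (rows : Vec (Vec S.Carrier n) k) L →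
                 value rows (expand row L) ≈ value (row ∷ rows) L
  expand-value row rows []             = refl
  expand-value row rows ((p , cs) ∷ L) = trans (⨁-value rows (cofactorTerms row (p , cs)) (expand row L))
    (+-cong (term-expand row rows p cs) (expand-value row rows L))

  total-value : ∀ {n} (L : Combination n 0) → ⟦ total L ⟧ ≈ value [] L
  total-value []            = ⟦⟧.0#-homo
  total-value ((p , _) ∷ L) =
    trans (⟦⟧.+-homo p (total L)) (+-cong (sym (*-identityʳ ⟦ p ⟧)) (total-value L))

  expandAll-value : ∀ {n k} (rows : Vec (Vec S.Carrier n) k) L → ⟦ expandAll rows L ⟧ ≈ value rows L
  expandAll-value []           L = total-value L
  expandAll-value (row ∷ rows) L =
    trans (expandAll-value rows (expand row L)) (expand-value row rows L)

  mergedDet-homo : ∀ {n} (A : Matrix S n) → ⟦ mergedDet A ⟧ ≈ det rawRing (λ i j → ⟦ A i j ⟧)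
  mergedDet-homo A = begin
    ⟦ mergedDet A ⟧                        ≈⟨ expandAll-value rows ((S.1# , cs) ∷ []) ⟩
    ⟦ S.1# ⟧ * minor rows cs + 0#          ≈⟨ +-identityʳ _ ⟩
    ⟦ S.1# ⟧ * minor rows cs               ≈⟨ *-congʳ ⟦⟧.1#-homo ⟩
    1# * minor rows cs                     ≈⟨ *-identityˡ _ ⟩
    minor rows cs                          ≈⟨ det-cong R (λ i j → reflexive (≡.cong ⟦_⟧ (entry i j))) ⟩
    det rawRing (λ i j → ⟦ A i j ⟧)        ∎
    where
    rows = tabulate (λ i → tabulate (A i))
    cs   = Vec.allFin _
    entry : ∀ i j → lookupᵛ (lookupᵛ rows i) (lookupᵛ cs j) ≡ A i j
    entry i j = ≡.trans
      (≡.cong₂ lookupᵛ (Vec.lookup∘tabulate (λ i → tabulate (A i)) i) (Vec.lookup∘tabulate (λ k → k) j))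
      (Vec.lookup∘tabulate (A i) j)

-- The characteristic polynomial of a line graph

module _ {c ℓ} (R : CommutativeRing c ℓ) where
  open CommutativeRing R hiding (zero)
  open Minors ℤ[X] zeroᴾ? using (mergedDet)

  charPoly-homo : ∀ {ι} (ι-hom : RingMorphisms.IsRingHomomorphism ℤ.+-*-rawRing rawRing ι)
    {n} (es : List (Fin n × Fin n)) x →
    ⟦_⟧ R ι-hom (mergedDet (charMatrix (lineMatrix ℤ[X] es))) x ≈
    charPoly rawRing (lineMatrix rawRing es) x
  charPoly-homo ι-hom es x = trans (mergedDet-homo (charMatrix A)) (det-cong R entry-homo)
    where
    open MinorsHomo ℤ[X] zeroᴾ? R (eval-hom R ι-hom x)
    module ⟦⟧ = RingMorphisms.IsRingHomomorphism (eval-hom R ι-hom x)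
    A = lineMatrix ℤ[X] es
    if-homo : ∀ b → ⟦_⟧ R ι-hom (if b then RawRing.1# ℤ[X] else RawRing.0# ℤ[X]) x ≈
                    (if b then 1# else 0#)
    if-homo true  = ⟦⟧.1#-homo
    if-homo false = ⟦⟧.0#-homo
    entry-homo : ∀ i j → ⟦_⟧ R ι-hom (charMatrix A i j) x ≈
                         x * identity rawRing i j + - lineMatrix rawRing es i j
    entry-homo i j = trans (⟦⟧.+-homo (mulᴾ X (identity ℤ[X] i j)) (List.map (ℤ.-_) (A i j)))
      (+-cong (trans (⟦⟧.*-homo X (identity ℤ[X] i j))
                     (*-cong (⟦X⟧ R ι-hom x) (if-homo (does (i Fin.≟ j)))))
              (trans (⟦⟧.-‿homo (A i j)) (-‿cong (if-homo _))))

-- Factorisation of monic polynomials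

module _ {c ℓ} (R : CommutativeRing c ℓ) where
  open CommutativeRing R hiding (zero)
  open import Relation.Binary.Reasoning.Setoid setoid
  open SemiringSolver commutativeSemiring using (solve; _:=_; _:+_; _:*_; con)
  open RawSemiringOps (RawRing.rawSemiring rawRing) using (product)

  eval-cong : ∀ p {x y} → x ≈ y → eval R p x ≈ eval R p y
  eval-cong []      x≈y = refl
  eval-cong (c ∷ p) x≈y = +-congˡ (*-cong x≈y (eval-cong p x≈y))

  -- Synthetic division by x - a: its coefficients are the intermediate values of Horner's scheme at
  -- `a`.
  quotient : Carrier → List Carrier → List Carrier
  quotient a []              = []
  quotient a (c ∷ [])        = []
  quotient a (c ∷ p@(_ ∷ _)) = eval R p a ∷ quotient a p

  -- Naming the difference `d` keeps subtraction out of the identity, so the solver for commutative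
  -- semirings applies.
  remainder : ∀ p {x} a d → x ≈ a + d → eval R p x ≈ eval R p a + d * eval R (quotient a p) x
  remainder []       {x} a d x≈a+d = solve 1 (λ d → con 0 := con 0 :+ d :* con 0) refl d
  remainder (c ∷ []) {x} a d x≈a+d =
    solve 4 (λ c x a d → c :+ x :* con 0 := (c :+ a :* con 0) :+ d :* con 0) refl c x a d
  remainder (c ∷ p@(_ ∷ _)) {x} a d x≈a+d = begin
    c + x * eval R p x                     ≈⟨ +-congˡ (*-cong x≈a+d (remainder p a d x≈a+d)) ⟩
    c + (a + d) * (r + d * q)              ≈⟨ solve 5 (λ c a d r q →
        c :+ (a :+ d) :* (r :+ d :* q) := (c :+ a :* r) :+ d :* (r :+ (a :+ d) :* q)) refl c a d r q ⟩
    (c + a * r) + d * (r + (a + d) * q)    ≈⟨ +-congˡ (*-congˡ (+-congˡ (*-congʳ x≈a+d))) ⟨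
    (c + a * r) + d * (r + x * q)          ∎
    where
    r = eval R p a
    q = eval R (quotient a p) x

  data Monic : ℕ → List Carrier → Set (c ⊔ ℓ) where
    one : ∀ {c} → c ≈ 1# → Monic 0 (c ∷ [])
    _∷_ : ∀ {n} c {p} → Monic n p → Monic (suc n) (c ∷ p)

  quotient-monic : ∀ {n p} a → Monic (suc n) p → Monic n (quotient a p)
  quotient-monic {n} a (_ ∷ one {c} c≈1) = one (begin
    c + a * 0#  ≈⟨ +-congˡ (zeroʳ a) ⟩
    c + 0#      ≈⟨ +-identityʳ c ⟩
    c           ≈⟨ c≈1 ⟩
    1#          ∎)
  quotient-monic {n} a (_ ∷ m@(_ ∷ _)) = _ ∷ quotient-monic a m

  Regular : Carrier → Set _
  Regular x = ∀ y → x * y ≈ 0# → y ≈ 0#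

  rootProduct : ∀ {n} → Vec Carrier n → Carrier → Carrier
  rootProduct zs x = product (λ i → x + - lookupᵛ zs i)

  rootProduct-++ : ∀ {m n} (zs : Vec Carrier m) (ws : Vec Carrier n) x →
                   rootProduct (zs ++ ws) x ≈ rootProduct zs x * rootProduct ws x
  rootProduct-++ []       ws x = sym (*-identityˡ _)
  rootProduct-++ (z ∷ zs) ws x = trans (*-congˡ (rootProduct-++ zs ws x)) (sym (*-assoc _ _ _))

  -- A record type is compared by its parameters, so unification recovers `p` and `zs` without
  -- inverting `eval`.
  record _SplitsAs_ {n} (p : List Carrier) (zs : Vec Carrier n) : Set (c ⊔ ℓ) where
    constructor splitsAs
    field eval≈ : ∀ x → eval R p x ≈ rootProduct zs x

  open _SplitsAs_ public

  splitsAs-++ : ∀ {ι} (ι-hom : RingMorphisms.IsRingHomomorphism ℤ.+-*-rawRing rawRing ι) p q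
    {m n} {zs : Vec Carrier m} {ws : Vec Carrier n} →
    List.map ι p SplitsAs zs → List.map ι q SplitsAs ws →
    List.map ι (mulᴾ p q) SplitsAs (zs ++ ws)
  splitsAs-++ ι-hom p q {zs = zs} {ws} split-p split-q = splitsAs λ x →
    trans (mulᴾ-homo R ι-hom x p q)
      (trans (*-cong (eval≈ split-p x) (eval≈ split-q x)) (sym (rootProduct-++ zs ws x)))

  split : ∀ x a → x ≈ a + (x - a)
  split x a = sym (begin
    a + (x - a)  ≈⟨ solve 3 (λ a x b → a :+ (x :+ b) := x :+ (a :+ b)) refl a x (- a) ⟩
    x + (a - a)  ≈⟨ +-congˡ (-‿inverseʳ a) ⟩
    x + 0#       ≈⟨ +-identityʳ x ⟩
    x            ∎)

  -- After dividing out the head `z`, every later `w` satisfies (w - z) q(w) ≈ p(w) ≈ 0, and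
  -- regularity of w - z leaves q(w) ≈ 0. There are as many roots as the degree, so the last
  -- quotient is the leading coefficient 1.
  factor : ∀ {n p} → Monic n p → (zs : Vec Carrier n) →
           All (λ z → eval R p z ≈ 0#) zs → AllPairs (λ z w → Regular (w - z)) zs →
           p SplitsAs zs
  factor (one {c} c≈1) [] _ _ = splitsAs λ x → begin
    c + x * 0#  ≈⟨ +-congˡ (zeroʳ x) ⟩
    c + 0#      ≈⟨ +-identityʳ c ⟩
    c           ≈⟨ c≈1 ⟩
    1#          ∎
  factor {p = p} m@(_ ∷ _) (z ∷ zs) (pz≈0 ∷ pzs≈0) (reg ∷ regs) = splitsAs λ x → begin
    eval R p x
      ≈⟨ remainder p z (x - z) (split x z) ⟩
    eval R p z + (x - z) * eval R q x
      ≈⟨ +-cong pz≈0 (*-congˡ (eval≈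
           (factor (quotient-monic z m) zs (All.map root-q (All.zip (pzs≈0 , reg))) regs) x)) ⟩
    0# + (x - z) * rootProduct zs x
      ≈⟨ +-identityˡ _ ⟩
    (x - z) * rootProduct zs x ∎
    where
    q = quotient z p
    root-q : ∀ {w} → eval R p w ≈ 0# × Regular (w - z) → eval R q w ≈ 0#
    root-q {w} (pw≈0 , reg) = reg (eval R q w) (begin
      (w - z) * eval R q w               ≈⟨ +-identityˡ _ ⟨
      0# + (w - z) * eval R q w          ≈⟨ +-congʳ pz≈0 ⟨
      eval R p z + (w - z) * eval R q w  ≈⟨ remainder p z (w - z) (split w z) ⟨
      eval R p w                         ≈⟨ pw≈0 ⟩
      0#                                 ∎)

  -- The computed determinant enters as an equation with a variable `p`, so nothing here depends on
  -- evaluating it.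
  charPoly-rootProduct : ∀ {ι} (ι-hom : RingMorphisms.IsRingHomomorphism ℤ.+-*-rawRing rawRing ι)
    {n} (es : List (Fin n × Fin n)) {p} {zs : Vec Carrier (length es)} →
    Minors.mergedDet ℤ[X] zeroᴾ? (charMatrix (lineMatrix ℤ[X] es)) ≡ p →
    List.map ι p SplitsAs zs →
    ∀ x → charPoly rawRing (lineMatrix rawRing es) x ≈ rootProduct zs x
  charPoly-rootProduct ι-hom es ≡.refl split x =
    trans (sym (charPoly-homo R ι-hom es x)) (eval≈ split x)

-- Spectra over an abstract ring

module _ {c ℓ} (S : RawRing c ℓ) (isCommutativeRing : IsCommutativeRing
  (RawRing._≈_ S) (RawRing._+_ S) (RawRing._*_ S) (RawRing.-_ S) (RawRing.0# S) (RawRing.1# S)) where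

  open RawRing S

  commutativeRing : CommutativeRing c ℓ
  commutativeRing = record { isCommutativeRing = isCommutativeRing }

  open RawSemiringOps rawSemiring using (product)

  record Spectrum {n} (A : Matrix S n) (zs : Vec Carrier n) : Set (c ⊔ ℓ) where
    field charPoly≈product : ∀ x → charPoly S A x ≈ product (λ i → x + - lookupᵛ zs i)

  lineMatrix-spectrum : ∀ {ι} (ι-hom : RingMorphisms.IsRingHomomorphism ℤ.+-*-rawRing S ι)
    {n} (es : List (Fin n × Fin n)) {A : Matrix S (length es)} {p} {zs : Vec Carrier (length es)} →
    (∀ i j → lineMatrix S es i j ≡ A i j) →
    Minors.mergedDet ℤ[X] zeroᴾ? (charMatrix (lineMatrix ℤ[X] es)) ≡ p →
    _SplitsAs_ commutativeRing (List.map ι p) zs → Spectrum A zs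
  lineMatrix-spectrum ι-hom es {zs = zs} lineMatrix≡A χ≡p split = record
    { charPoly≈product = λ x → trans
        (det-cong commutativeRing (λ i j → +-congˡ (-‿cong (sym (reflexive (lineMatrix≡A i j))))))
        (charPoly-rootProduct commutativeRing ι-hom es {zs = zs} χ≡p split x) }
    where
    open CommutativeRing commutativeRing using (trans; sym; reflexive; +-congˡ; -‿cong)

  -- The operations and the roots enter through propositional equations because, for Cauchy reals,
  -- conversion checking between two spellings of the same term unfolds all Cauchy proofs.
  charPoly≈ : ∀ {n} {A : Matrix S n} {zs} → Spectrum A zs →
    ∀ {z : Fin n → Carrier} {_⊕_ ⊖_} → (∀ i → lookupᵛ zs i ≡ z i) → _+_ ≡ _⊕_ → -_ ≡ ⊖_ →
    ∀ x {y} → product (λ i → x ⊕ (⊖ z i)) ≡ y → charPoly S A x ≈ y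
  charPoly≈ σ lookup≗z ≡.refl ≡.refl x ≡.refl = trans (Spectrum.charPoly≈product σ x)
    (product-cong (λ i → +-congˡ (-‿cong (reflexive (lookup≗z i)))))
    where
    open CommutativeRing commutativeRing using (trans; reflexive; +-congˡ; -‿cong; *-commutativeMonoid)
    open MonoidSum (CommutativeMonoid.monoid *-commutativeMonoid)
      using () renaming (sum-cong-≋ to product-cong)

-- The ring of Cauchy reals

open import Defs using (ℝ; mkℝ; seq; cauchy; Cauchy; _≈_; -_; 0ℝ; 1ℝ; fromℚ; ℝ-rawRing)
  renaming (_+_ to _+ℝ_; _*_ to _*ℝ_)
open +-*-Solver using (solve; _:=_; _:+_; _:*_; _:-_; :-_; con)
open RawSemiringOps (RawRing.rawSemiring ℝ-rawRing) using (product)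
open ≡ using (refl; sym; trans; cong; cong₂; subst; subst₂)

p≤∣p∣ : ∀ p → p ℚ.≤ ∣ p ∣
p≤∣p∣ p with ℚ.≤-total 0ℚ p
... | inj₁ 0≤p = ℚ.≤-reflexive (sym (ℚ.0≤p⇒∣p∣≡p 0≤p))
... | inj₂ p≤0 = ℚ.≤-trans p≤0 (ℚ.0≤∣p∣ p)

-- By unfolding, `x ≈ y` is `Null` of the termwise difference, so congruence laws become closure
-- properties of null sequences.
Null : (ℕ → ℚ) → Set
Null f = ∀ ε → 0ℚ ℚ.< ε → ∃[ N ] (∀ {n} → N ℕ.≤ n → ∣ f n ∣ ℚ.≤ ε)

null-≤ : ∀ {f g} → (∀ n → ∣ g n ∣ ℚ.≤ ∣ f n ∣) → Null f → Null g
null-≤ g≤f f-null ε 0<ε with f-null ε 0<ε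
... | N , hf = N , λ {n} N≤n → ℚ.≤-trans (g≤f n) (hf N≤n)

null-≗ : ∀ {f g} → (∀ n → f n ≡ g n) → Null f → Null g
null-≗ f≗g = null-≤ (λ n → ℚ.≤-reflexive (cong ∣_∣ (sym (f≗g n))))

null-neg : ∀ {f} → Null f → Null (λ n → ℚ.- f n)
null-neg {f} = null-≤ (λ n → ℚ.≤-reflexive (ℚ.∣-p∣≡∣p∣ (f n)))

null-+ : ∀ {f g} → Null f → Null g → Null (λ n → f n ℚ.+ g n)
null-+ {f} {g} f-null g-null ε 0<ε = M ℕ.⊔ N , λ {n} ≤n → begin
  ∣ f n ℚ.+ g n ∣        ≤⟨ ℚ.∣p+q∣≤∣p∣+∣q∣ (f n) (g n) ⟩
  ∣ f n ∣ ℚ.+ ∣ g n ∣    ≤⟨ ℚ.+-mono-≤ (proj₂ hf (ℕ.m⊔n≤o⇒m≤o M N ≤n))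
                                       (proj₂ hg (ℕ.m⊔n≤o⇒n≤o M N ≤n)) ⟩
  ½ ℚ.* ε ℚ.+ ½ ℚ.* ε    ≡⟨ ℚ.*-distribʳ-+ ε ½ ½ ⟨
  1ℚ ℚ.* ε               ≡⟨ ℚ.*-identityˡ ε ⟩
  ε                      ∎
  where
  open ℚ.≤-Reasoning
  0<½ε : 0ℚ ℚ.< ½ ℚ.* ε
  0<½ε = subst (ℚ._< ½ ℚ.* ε) (ℚ.*-zeroʳ ½) (ℚ.*-monoʳ-<-pos ½ 0<ε)
  hf = f-null (½ ℚ.* ε) 0<½ε
  hg = g-null (½ ℚ.* ε) 0<½ε
  M = proj₁ hf
  N = proj₁ hg

-- A Cauchy sequence is eventually bounded, by `B` = 1 + |f M| with `M` its index for tolerance 1;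
-- then g is taken below ε / B.
null-* : ∀ {f g} → Cauchy f → Null g → Null (λ n → f n ℚ.* g n)
null-* {f} {g} f-cauchy g-null ε 0<ε = M ℕ.⊔ N , λ {n} ≤n → begin
  ∣ f n ℚ.* g n ∣      ≡⟨ ℚ.∣p*q∣≡∣p∣*∣q∣ (f n) (g n) ⟩
  ∣ f n ∣ ℚ.* ∣ g n ∣  ≤⟨ ℚ.*-monoʳ-≤-nonNeg ∣ g n ∣ {{ℚ.nonNegative (ℚ.0≤∣p∣ (g n))}}
                            (bound (ℕ.m⊔n≤o⇒m≤o M N ≤n)) ⟩
  B ℚ.* ∣ g n ∣        ≤⟨ ℚ.*-monoˡ-≤-nonNeg B {{ℚ.pos⇒nonNeg B}} (proj₂ hg (ℕ.m⊔n≤o⇒n≤o M N ≤n)) ⟩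
  B ℚ.* (1/ B ℚ.* ε)   ≡⟨ ℚ.*-assoc B (1/ B) ε ⟨
  (B ℚ.* 1/ B) ℚ.* ε   ≡⟨ cong (ℚ._* ε) (ℚ.*-inverseʳ B) ⟩
  1ℚ ℚ.* ε             ≡⟨ ℚ.*-identityˡ ε ⟩
  ε                    ∎
  where
  open ℚ.≤-Reasoning
  hf = f-cauchy 1ℚ (from-yes (0ℚ ℚ.<? 1ℚ))
  M = proj₁ hf
  B = 1ℚ ℚ.+ ∣ f M ∣
  bound : ∀ {n} → M ℕ.≤ n → ∣ f n ∣ ℚ.≤ B
  bound {n} M≤n = begin
    ∣ f n ∣                      ≡⟨ cong ∣_∣ (solve 2 (λ a b → a := (a :- b) :+ b) refl (f n) (f M)) ⟩
    ∣ (f n ℚ.- f M) ℚ.+ f M ∣    ≤⟨ ℚ.∣p+q∣≤∣p∣+∣q∣ (f n ℚ.- f M) (f M) ⟩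
    ∣ f n ℚ.- f M ∣ ℚ.+ ∣ f M ∣  ≤⟨ ℚ.+-monoˡ-≤ ∣ f M ∣ (proj₂ hf M≤n ℕ.≤-refl) ⟩
    B                            ∎
  instance
    B-pos : ℚ.Positive B
    B-pos = ℚ.positive (ℚ.+-mono-<-≤ (from-yes (0ℚ ℚ.<? 1ℚ)) (ℚ.0≤∣p∣ (f M)))
    B-nonZero : ℚ.NonZero B
    B-nonZero = ℚ.pos⇒nonZero B
    1/B-pos : ℚ.Positive (1/ B)
    1/B-pos = ℚ.1/pos⇒pos B
  hg = g-null (1/ B ℚ.* ε)
    (subst (ℚ._< 1/ B ℚ.* ε) (ℚ.*-zeroʳ (1/ B)) (ℚ.*-monoʳ-<-pos (1/ B) 0<ε))
  N = proj₁ hg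

≗⇒≈ : ∀ {x y} → (∀ n → seq x n ≡ seq y n) → x ≈ y
≗⇒≈ {x} {y} x≗y ε 0<ε = 0 , λ {n} _ → subst (λ q → ∣ q ∣ ℚ.≤ ε)
  (sym (trans (cong (ℚ._- seq y n) (x≗y n)) (ℚ.+-inverseʳ (seq y n)))) (ℚ.<⇒≤ 0<ε)

≈-sym : ∀ {x y} → x ≈ y → y ≈ x
≈-sym {x} {y} x≈y = null-≗
  (λ n → solve 2 (λ a b → :- (a :- b) := b :- a) refl (seq x n) (seq y n)) (null-neg x≈y)

≈-trans : ∀ {x y z} → x ≈ y → y ≈ z → x ≈ z
≈-trans {x} {y} {z} x≈y y≈z = null-≗
  (λ n → solve 3 (λ a b c → (a :- b) :+ (b :- c) := a :- c) refl (seq x n) (seq y n) (seq z n))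
  (null-+ x≈y y≈z)

+-cong-≈ : ∀ {x y u v} → x ≈ y → u ≈ v → x +ℝ u ≈ y +ℝ v
+-cong-≈ {x} {y} {u} {v} x≈y u≈v = null-≗
  (λ n → solve 4 (λ a b c d → (a :- b) :+ (c :- d) := (a :+ c) :- (b :+ d)) refl
    (seq x n) (seq y n) (seq u n) (seq v n))
  (null-+ x≈y u≈v)

-‿cong-≈ : ∀ {x y} → x ≈ y → - x ≈ - y
-‿cong-≈ {x} {y} x≈y = null-≗
  (λ n → ℚ.neg-distrib-+ (seq x n) (ℚ.- seq y n)) (null-neg x≈y)

*-cong-≈ : ∀ {x y u v} → x ≈ y → u ≈ v → x *ℝ u ≈ y *ℝ v
*-cong-≈ {x} {y} {u} {v} x≈y u≈v = null-≗
  (λ n → solve 4 (λ a b c d → a :* (c :- d) :+ d :* (a :- b) := a :* c :- b :* d) refl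
    (seq x n) (seq y n) (seq u n) (seq v n))
  (null-+ (null-* {seq x} (cauchy x) u≈v) (null-* {seq v} (cauchy v) x≈y))

-- The laws hold term by term in `ℚ`. The reals are passed explicitly because `_≈_` unfolds to their
-- `seq` fields, from which the `cauchy` fields cannot be inferred.
ℝ-isCommutativeRing : IsCommutativeRing _≈_ _+ℝ_ _*ℝ_ -_ 0ℝ 1ℝ
ℝ-isCommutativeRing = record
  { isRing = record
    { +-isAbelianGroup = record
      { isGroup = record
        { isMonoid = record
          { isSemigroup = record
            { isMagma = record
              { isEquivalence = record
                { refl  = λ {x} → ≗⇒≈ {x} {x} (λ _ → refl)
                ; sym   = λ {x} {y} → ≈-sym {x} {y}
                ; trans = λ {x} {y} {z} → ≈-trans {x} {y} {z} }
              ; ∙-cong = λ {x} {y} {u} {v} → +-cong-≈ {x} {y} {u} {v} }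
            ; assoc = λ x y z → ≗⇒≈ {(x +ℝ y) +ℝ z} {x +ℝ (y +ℝ z)}
                (λ n → ℚ.+-assoc (seq x n) (seq y n) (seq z n)) }
          ; identity = (λ x → ≗⇒≈ {0ℝ +ℝ x} {x} (λ n → ℚ.+-identityˡ (seq x n)))
                     , (λ x → ≗⇒≈ {x +ℝ 0ℝ} {x} (λ n → ℚ.+-identityʳ (seq x n))) }
        ; inverse = (λ x → ≗⇒≈ {(- x) +ℝ x} {0ℝ} (λ n → ℚ.+-inverseˡ (seq x n)))
                  , (λ x → ≗⇒≈ {x +ℝ (- x)} {0ℝ} (λ n → ℚ.+-inverseʳ (seq x n)))
        ; ⁻¹-cong = λ {x} {y} → -‿cong-≈ {x} {y} }
      ; comm = λ x y → ≗⇒≈ {x +ℝ y} {y +ℝ x} (λ n → ℚ.+-comm (seq x n) (seq y n)) }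
    ; *-cong = λ {x} {y} {u} {v} → *-cong-≈ {x} {y} {u} {v}
    ; *-assoc = λ x y z → ≗⇒≈ {(x *ℝ y) *ℝ z} {x *ℝ (y *ℝ z)}
        (λ n → ℚ.*-assoc (seq x n) (seq y n) (seq z n))
    ; *-identity = (λ x → ≗⇒≈ {1ℝ *ℝ x} {x} (λ n → ℚ.*-identityˡ (seq x n)))
                 , (λ x → ≗⇒≈ {x *ℝ 1ℝ} {x} (λ n → ℚ.*-identityʳ (seq x n)))
    ; distrib = (λ x y z → ≗⇒≈ {x *ℝ (y +ℝ z)} {x *ℝ y +ℝ x *ℝ z}
                  (λ n → ℚ.*-distribˡ-+ (seq x n) (seq y n) (seq z n)))
              , (λ x y z → ≗⇒≈ {(y +ℝ z) *ℝ x} {y *ℝ x +ℝ z *ℝ x}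
                  (λ n → ℚ.*-distribʳ-+ (seq x n) (seq y n) (seq z n))) }
  ; *-comm = λ x y → ≗⇒≈ {x *ℝ y} {y *ℝ x} (λ n → ℚ.*-comm (seq x n) (seq y n)) }

ℝ-commutativeRing : CommutativeRing 0ℓ 0ℓ
ℝ-commutativeRing = commutativeRing ℝ-rawRing ℝ-isCommutativeRing

-- Since δ |yₙ| ≤ |xₙ yₙ|, tolerance δ ε for the product gives tolerance ε for y; only the rational
-- δ is cancelled.
≥-pos⇒regular : ∀ x δ → 0ℚ ℚ.< δ → (∀ n → δ ℚ.≤ seq x n) → Regular ℝ-commutativeRing x
≥-pos⇒regular x δ 0<δ δ≤x y xy≈0 ε 0<ε with xy≈0 (δ ℚ.* ε)
  (subst (ℚ._< δ ℚ.* ε) (ℚ.*-zeroʳ δ) (ℚ.*-monoʳ-<-pos δ {{ℚ.positive 0<δ}} 0<ε))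
... | N , h = N , λ {n} N≤n → ℚ.*-cancelˡ-≤-pos δ {{ℚ.positive 0<δ}} (begin
  δ ℚ.* ∣ seq y n ℚ.- 0ℚ ∣              ≡⟨ cong (λ q → δ ℚ.* ∣ q ∣) (ℚ.+-identityʳ (seq y n)) ⟩
  δ ℚ.* ∣ seq y n ∣                     ≤⟨ ℚ.*-monoʳ-≤-nonNeg ∣ seq y n ∣ {{ℚ.nonNegative (ℚ.0≤∣p∣ (seq y n))}}
                                             (ℚ.≤-trans (δ≤x n) (p≤∣p∣ (seq x n))) ⟩
  ∣ seq x n ∣ ℚ.* ∣ seq y n ∣           ≡⟨ ℚ.∣p*q∣≡∣p∣*∣q∣ (seq x n) (seq y n) ⟨
  ∣ seq x n ℚ.* seq y n ∣               ≡⟨ cong ∣_∣ (ℚ.+-identityʳ (seq x n ℚ.* seq y n)) ⟨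
  ∣ seq x n ℚ.* seq y n ℚ.- 0ℚ ∣        ≤⟨ h N≤n ⟩
  δ ℚ.* ε                               ∎)
  where open ℚ.≤-Reasoning

-- Integers and integer polynomials over the rationals and reals

fromℤ-+ : ∀ a b → fromℤ (a ℤ.+ b) ≡ fromℤ a ℚ.+ fromℤ b
fromℤ-+ a b = ℚ.toℚᵘ-injective (ℚᵘ.≃-trans
  (ℚᵘ.≃-reflexive (cong (λ c → ℚᵘ.mkℚᵘ c 0)
    (cong₂ ℤ._+_ (sym (ℤ.*-identityʳ a)) (sym (ℤ.*-identityʳ b)))))
  (ℚᵘ.≃-sym (ℚ.toℚᵘ-homo-+ (fromℤ a) (fromℤ b))))

fromℤ-* : ∀ a b → fromℤ (a ℤ.* b) ≡ fromℤ a ℚ.* fromℤ b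
fromℤ-* a b = ℚ.toℚᵘ-injective (ℚᵘ.≃-sym (ℚ.toℚᵘ-homo-* (fromℤ a) (fromℤ b)))

fromℤ-neg : ∀ a → fromℤ (ℤ.- a) ≡ ℚ.- fromℤ a
fromℤ-neg a = ℚ.toℚᵘ-injective (ℚᵘ.≃-sym (ℚ.toℚᵘ-homo‿- (fromℤ a)))

ι : ℤ → ℝ
ι = fromℚ ∘ fromℤ

ι-hom : RingMorphisms.IsRingHomomorphism ℤ.+-*-rawRing ℝ-rawRing ι
ι-hom = record
  { isSemiringHomomorphism = record
    { isNearSemiringHomomorphism = record
      { +-isMonoidHomomorphism = record
        { isMagmaHomomorphism = record
          { isRelHomomorphism = record { cong = λ {a} {b} a≡b → ≗⇒≈ {ι a} {ι b} (λ _ → cong fromℤ a≡b) }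
          ; homo = λ a b → ≗⇒≈ {ι (a ℤ.+ b)} {ι a +ℝ ι b} (λ _ → fromℤ-+ a b) }
        ; ε-homo = ≗⇒≈ {ι 0ℤ} {0ℝ} (λ _ → refl) }
      ; *-homo = λ a b → ≗⇒≈ {ι (a ℤ.* b)} {ι a *ℝ ι b} (λ _ → fromℤ-* a b) }
    ; 1#-homo = ≗⇒≈ {ι 1ℤ} {1ℝ} (λ _ → refl) }
  ; -‿homo = λ a → ≗⇒≈ {ι (ℤ.- a)} {(- ι a)} (λ _ → fromℤ-neg a) }

evalℚ : List ℤ → ℚ → ℚ
evalℚ p = eval ℚ.+-*-commutativeRing (List.map fromℤ p)

evalℝ : List ℤ → ℝ → ℝ
evalℝ p = eval ℝ-commutativeRing (List.map ι p)

seq-eval : ∀ p z n → seq (evalℝ p z) n ≡ evalℚ p (seq z n)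
seq-eval []      z n = refl
seq-eval (c ∷ p) z n = cong (λ q → fromℤ c ℚ.+ seq z n ℚ.* q) (seq-eval p z n)

-- Roots by bisection

∣p∣≤q : ∀ {p q} → p ℚ.≤ q → ℚ.- p ℚ.≤ q → ∣ p ∣ ℚ.≤ q
∣p∣≤q {p} p≤q -p≤q with ℚ.∣p∣≡p∨∣p∣≡-p p
... | inj₁ ∣p∣≡p  = subst (ℚ._≤ _) (sym ∣p∣≡p) p≤q
... | inj₂ ∣p∣≡-p = subst (ℚ._≤ _) (sym ∣p∣≡-p) -p≤q

∣p-q∣≤width : ∀ {a b p q} → a ℚ.≤ p → p ℚ.≤ b → a ℚ.≤ q → q ℚ.≤ b → ∣ p ℚ.- q ∣ ℚ.≤ b ℚ.- a
∣p-q∣≤width {a} {b} {p} {q} a≤p p≤b a≤q q≤b = ∣p∣≤q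
  (ℚ.+-mono-≤ p≤b (ℚ.neg-antimono-≤ a≤q))
  (subst (ℚ._≤ b ℚ.- a) (solve 2 (λ p q → q :- p := :- (p :- q)) refl p q)
    (ℚ.+-mono-≤ q≤b (ℚ.neg-antimono-≤ a≤p)))

-- The weak inequalities overlap at 0, so totality of the order on `ℚ` decides every bisection step,
-- and hitting a root exactly is no special case.
Opposite : ℚ → ℚ → Set
Opposite p q = (p ℚ.≤ 0ℚ × 0ℚ ℚ.≤ q) ⊎ (0ℚ ℚ.≤ p × q ℚ.≤ 0ℚ)

opposite⇒∣p∣≤∣p-q∣ : ∀ {p q} → Opposite p q → ∣ p ∣ ℚ.≤ ∣ p ℚ.- q ∣
opposite⇒∣p∣≤∣p-q∣ {p} {q} (inj₁ (p≤0 , 0≤q)) = begin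
  ∣ p ∣            ≤⟨ ∣p∣≤q (ℚ.≤-trans p≤0 0≤q-p) (p≤q+p 0≤q) ⟩
  q ℚ.- p          ≤⟨ p≤∣p∣ (q ℚ.- p) ⟩
  ∣ q ℚ.- p ∣      ≡⟨ ℚ.∣-p∣≡∣p∣ (q ℚ.- p) ⟨
  ∣ ℚ.- (q ℚ.- p) ∣ ≡⟨ cong ∣_∣ (solve 2 (λ p q → :- (q :- p) := p :- q) refl p q) ⟩
  ∣ p ℚ.- q ∣      ∎
  where
  open ℚ.≤-Reasoning
  0≤q-p : 0ℚ ℚ.≤ q ℚ.- p
  0≤q-p = ℚ.+-mono-≤ 0≤q (ℚ.neg-antimono-≤ p≤0)
  p≤q+p : ∀ {r s} → 0ℚ ℚ.≤ r → s ℚ.≤ r ℚ.+ s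
  p≤q+p {r} {s} 0≤r = subst (ℚ._≤ r ℚ.+ s) (ℚ.+-identityˡ s) (ℚ.+-monoˡ-≤ s 0≤r)
opposite⇒∣p∣≤∣p-q∣ {p} {q} (inj₂ (0≤p , q≤0)) = begin
  ∣ p ∣        ≡⟨ ℚ.0≤p⇒∣p∣≡p 0≤p ⟩
  p            ≡⟨ ℚ.+-identityʳ p ⟨
  p ℚ.+ 0ℚ     ≤⟨ ℚ.+-monoʳ-≤ p (ℚ.neg-antimono-≤ q≤0) ⟩
  p ℚ.- q      ≤⟨ p≤∣p∣ (p ℚ.- q) ⟩
  ∣ p ℚ.- q ∣  ∎
  where open ℚ.≤-Reasoning

fromℤ-mono-≤ : ∀ {a b} → a ℤ.≤ b → fromℤ a ℚ.≤ fromℤ b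
fromℤ-mono-≤ {a} {b} a≤b = *≤* (subst₂ ℤ._≤_ (sym (ℤ.*-identityʳ a)) (sym (ℤ.*-identityʳ b)) a≤b)

≤-fromℕ : ∀ q → ∃[ n ] q ℚ.≤ fromℤ (+ n)
≤-fromℕ q@record{} = n , *≤* (begin
  ℚ.↥ q ℤ.* 1ℤ                    ≡⟨ ℤ.*-identityʳ (ℚ.↥ q) ⟩
  ℚ.↥ q                           ≤⟨ i≤∣i∣ (ℚ.↥ q) ⟩
  + n                             ≤⟨ ℤ.+≤+ (ℕ.m≤m*n n (ℚ.↧ₙ q)) ⟩
  + (n ℕ.* ℚ.↧ₙ q)                ≡⟨ ℤ.pos-* n (ℚ.↧ₙ q) ⟩
  + n ℤ.* ℚ.↧ q                   ∎)
  where
  open ℤ.≤-Reasoning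
  n = ℤ.∣ ℚ.↥ q ∣
  i≤∣i∣ : ∀ i → i ℤ.≤ + ℤ.∣ i ∣
  i≤∣i∣ (+ _)      = ℤ.≤-refl
  i≤∣i∣ ℤ.-[1+ _ ] = ℤ.-≤+

archimedean : ∀ q ε → 0ℚ ℚ.< ε → ∃[ n ] q ℚ.≤ ε ℚ.* fromℤ (+ n)
archimedean q ε 0<ε with ≤-fromℕ (1/_ ε {{ℚ.>-nonZero 0<ε}} ℚ.* q)
... | n , h = n , (begin
  q                     ≡⟨ ℚ.*-identityˡ q ⟨
  1ℚ ℚ.* q              ≡⟨ cong (ℚ._* q) (ℚ.*-inverseʳ ε) ⟨
  (ε ℚ.* 1/ ε) ℚ.* q    ≡⟨ ℚ.*-assoc ε (1/ ε) q ⟩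
  ε ℚ.* (1/ ε ℚ.* q)    ≤⟨ ℚ.*-monoˡ-≤-nonNeg ε {{ℚ.nonNegative (ℚ.<⇒≤ 0<ε)}} h ⟩
  ε ℚ.* fromℤ (+ n)     ∎)
  where
  open ℚ.≤-Reasoning
  instance
    ε-nonZero : ℚ.NonZero ε
    ε-nonZero = ℚ.>-nonZero 0<ε

Within : ℚ × ℚ → ℝ → Set
Within (l , r) z = ∀ n → l ℚ.≤ seq z n × seq z n ℚ.≤ r

-- `P` and `Q` stand for the two weak sign conditions, in either order; rising and falling sign
-- changes are two instances.
module Bisection {P Q : ℚ → Set} (P∪Q : ∀ x → P x ⊎ Q x) where

  record Bracket : Set where
    field
      lo hi : ℚ
      lo≤hi : lo ℚ.≤ hi
      P-lo  : P lo
      Q-hi  : Q hi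
    width : ℚ
    width = hi ℚ.- lo

  open Bracket

  module _ (b : Bracket) where

    mid : ℚ
    mid = ½ ℚ.* (lo b ℚ.+ hi b)

    private
      ½x+½x≡x : ∀ x → ½ ℚ.* (x ℚ.+ x) ≡ x
      ½x+½x≡x = solve 1 (λ x → con ½ :* (x :+ x) := x) refl

    lo≤mid : lo b ℚ.≤ mid
    lo≤mid = subst (ℚ._≤ mid) (½x+½x≡x (lo b)) (ℚ.*-monoˡ-≤-nonNeg ½ (ℚ.+-monoʳ-≤ (lo b) (lo≤hi b)))

    mid≤hi : mid ℚ.≤ hi b
    mid≤hi = subst (mid ℚ.≤_) (½x+½x≡x (hi b)) (ℚ.*-monoˡ-≤-nonNeg ½ (ℚ.+-monoˡ-≤ (hi b) (lo≤hi b)))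

    halve : Bracket
    halve with P∪Q mid
    ... | inj₁ p = record { lo = mid ; hi = hi b ; lo≤hi = mid≤hi ; P-lo = p ; Q-hi = Q-hi b }
    ... | inj₂ q = record { lo = lo b ; hi = mid ; lo≤hi = lo≤mid ; P-lo = P-lo b ; Q-hi = q }

    halve-lo : lo b ℚ.≤ lo halve
    halve-lo with P∪Q mid
    ... | inj₁ _ = lo≤mid
    ... | inj₂ _ = ℚ.≤-refl

    halve-hi : hi halve ℚ.≤ hi b
    halve-hi with P∪Q mid
    ... | inj₁ _ = ℚ.≤-refl
    ... | inj₂ _ = mid≤hi

    halve-width : width halve ≡ ½ ℚ.* width b
    halve-width with P∪Q mid
    ... | inj₁ _ =
      solve 2 (λ l h → h :- con ½ :* (l :+ h) := con ½ :* (h :- l)) refl (lo b) (hi b)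
    ... | inj₂ _ =
      solve 2 (λ l h → con ½ :* (l :+ h) :- l := con ½ :* (h :- l)) refl (lo b) (hi b)

  module _ (b₀ : Bracket) where

    bisect : ℕ → Bracket
    bisect zero    = b₀
    bisect (suc n) = halve (bisect n)

    lo-mono : ∀ {m n} → m ℕ.≤′ n → lo (bisect m) ℚ.≤ lo (bisect n)
    lo-mono (≤′-reflexive refl) = ℚ.≤-refl
    lo-mono (≤′-step {n} m≤n)     = ℚ.≤-trans (lo-mono m≤n) (halve-lo (bisect n))

    hi-mono : ∀ {m n} → m ℕ.≤′ n → hi (bisect n) ℚ.≤ hi (bisect m)
    hi-mono (≤′-reflexive refl) = ℚ.≤-refl
    hi-mono (≤′-step {n} m≤n)     = ℚ.≤-trans (halve-hi (bisect n)) (hi-mono m≤n)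

    0≤width : ∀ n → 0ℚ ℚ.≤ width (bisect n)
    0≤width n = subst (ℚ._≤ width b) (ℚ.+-inverseʳ (lo b)) (ℚ.+-monoˡ-≤ (ℚ.- lo b) (lo≤hi b))
      where b = bisect n

    -- The widths shrink like 1/2ⁿ, but the bound 1/(n + 1) suffices, is inductive by n + 2 ≤ 2 (n +
    -- 1), and fits the Archimedean property directly.
    width-bound : ∀ n → width (bisect n) ℚ.* fromℤ (+ suc n) ℚ.≤ width b₀
    width-bound zero    = ℚ.≤-reflexive (ℚ.*-identityʳ (width b₀))
    width-bound (suc n) = begin
      width (bisect (suc n)) ℚ.* fromℤ (+ (2 ℕ.+ n))
        ≤⟨ ℚ.*-monoˡ-≤-nonNeg (width (bisect (suc n))) {{ℚ.nonNegative (0≤width (suc n))}}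
             (fromℤ-mono-≤ (ℤ.+≤+ 2+n≤)) ⟩
      width (bisect (suc n)) ℚ.* fromℤ (+ (2 ℕ.* suc n))
        ≡⟨ cong₂ ℚ._*_ (halve-width (bisect n))
             (trans (cong fromℤ (ℤ.pos-* 2 (suc n))) (fromℤ-* (+ 2) (+ suc n))) ⟩
      (½ ℚ.* w) ℚ.* (fromℤ (+ 2) ℚ.* N)
        ≡⟨ solve 2 (λ w N → (con ½ :* w) :* (con (fromℤ (+ 2)) :* N) := w :* N) refl w N ⟩
      w ℚ.* N
        ≤⟨ width-bound n ⟩
      width b₀ ∎
      where
      open ℚ.≤-Reasoning
      w = width (bisect n)
      N = fromℤ (+ suc n)
      2+n≤ : 2 ℕ.+ n ℕ.≤ 2 ℕ.* suc n
      2+n≤ = subst (2 ℕ.+ n ℕ.≤_) (sym (ℕ.*-suc 2 n)) (ℕ.+-monoʳ-≤ 2 (ℕ.m≤m+n n (n ℕ.+ 0)))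

    width-null : Null (λ n → width (bisect n))
    width-null ε 0<ε with archimedean (width b₀) ε 0<ε
    ... | N , h = N , λ {n} N≤n →
      subst (ℚ._≤ ε) (sym (ℚ.0≤p⇒∣p∣≡p (0≤width n))) (ℚ.*-cancelʳ-≤-pos (fromℤ (+ suc n)) (begin
        width (bisect n) ℚ.* fromℤ (+ suc n)  ≤⟨ width-bound n ⟩
        width b₀                              ≤⟨ h ⟩
        ε ℚ.* fromℤ (+ N)                     ≤⟨ ℚ.*-monoˡ-≤-nonNeg ε {{ℚ.nonNegative (ℚ.<⇒≤ 0<ε)}}
                                                   (fromℤ-mono-≤ (ℤ.+≤+ (ℕ.m≤n⇒m≤1+n N≤n))) ⟩
        ε ℚ.* fromℤ (+ suc n)                 ∎))
      where open ℚ.≤-Reasoning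

    nested-cauchy : ∀ {f} →
      (∀ {N n} → N ℕ.≤ n → lo (bisect N) ℚ.≤ f n × f n ℚ.≤ hi (bisect N)) → Cauchy f
    nested-cauchy nested ε 0<ε with width-null ε 0<ε
    ... | N , h = N , λ {m} {n} N≤m N≤n → ℚ.≤-trans
      (∣p-q∣≤width (proj₁ (nested N≤m)) (proj₂ (nested N≤m))
                   (proj₁ (nested N≤n)) (proj₂ (nested N≤n)))
      (ℚ.≤-trans (p≤∣p∣ (width (bisect N))) (h ℕ.≤-refl))

    -- Equal as reals, but kept apart because `P` holds along one sequence and `Q` along the other.
    lower upper : ℝ
    lower = mkℝ (λ n → lo (bisect n)) (nested-cauchy λ {N} {n} N≤n →
      lo-mono (ℕ.≤⇒≤′ N≤n) , ℚ.≤-trans (lo≤hi (bisect n)) (hi-mono (ℕ.≤⇒≤′ N≤n)))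
    upper = mkℝ (λ n → hi (bisect n)) (nested-cauchy λ {N} {n} N≤n →
      ℚ.≤-trans (lo-mono (ℕ.≤⇒≤′ N≤n)) (lo≤hi (bisect n)) , hi-mono (ℕ.≤⇒≤′ N≤n))

    lower≈upper : lower ≈ upper
    lower≈upper = null-≤ (λ n → ℚ.≤-trans
      (∣p-q∣≤width ℚ.≤-refl (lo≤hi (bisect n)) (lo≤hi (bisect n)) ℚ.≤-refl)
      (p≤∣p∣ (width (bisect n)))) width-null

    lower-within : Within (lo b₀ , hi b₀) lower
    lower-within n = lo-mono {n = n} ℕ.z≤′n , ℚ.≤-trans (lo≤hi (bisect n)) (hi-mono {n = n} ℕ.z≤′n)

Changes : List ℤ → ℚ × ℚ → Set
Changes p (l , r) = l ℚ.≤ r × Opposite (evalℚ p l) (evalℚ p r)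

-- At the two ends of each bracket p has opposite signs, so |p(lowerₙ)| ≤ |p(lowerₙ) - p(upperₙ)|.
-- The right side is null because evaluation respects `_≈_`, which takes the place of continuity.
intermediate-root : ∀ p I → Changes p I → ∃[ z ] (Within I z × evalℝ p z ≈ 0ℝ)
intermediate-root p (l , r) (l≤r , opp) = by-sign opp
  where
  module _ {P Q : ℚ → Set} (P∪Q : ∀ x → P x ⊎ Q x)
           (opposite : ∀ {x y} → P x → Q y → Opposite (evalℚ p x) (evalℚ p y))
           (Pl : P l) (Qr : Q r) where
    open Bisection P∪Q
    b : Bracket
    b = record { lo = l ; hi = r ; lo≤hi = l≤r ; P-lo = Pl ; Q-hi = Qr }

    eval-lower≈upper : evalℝ p (lower b) ≈ evalℝ p (upper b)
    eval-lower≈upper = eval-cong ℝ-commutativeRing (List.map ι p) {lower b} {upper b} (lower≈upper b)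

    eval-bound : ∀ n → ∣ seq (evalℝ p (lower b)) n ℚ.- 0ℚ ∣ ℚ.≤
                       ∣ seq (evalℝ p (lower b)) n ℚ.- seq (evalℝ p (upper b)) n ∣
    eval-bound n = begin
      ∣ seq (evalℝ p (lower b)) n ℚ.- 0ℚ ∣  ≡⟨ cong ∣_∣ (ℚ.+-identityʳ (seq (evalℝ p (lower b)) n)) ⟩
      ∣ seq (evalℝ p (lower b)) n ∣         ≡⟨ cong ∣_∣ (seq-eval p (lower b) n) ⟩
      ∣ evalℚ p (lo bₙ) ∣                   ≤⟨ opposite⇒∣p∣≤∣p-q∣ (opposite (P-lo bₙ) (Q-hi bₙ)) ⟩
      ∣ evalℚ p (lo bₙ) ℚ.- evalℚ p (hi bₙ) ∣
        ≡⟨ cong₂ (λ s t → ∣ s ℚ.- t ∣) (seq-eval p (lower b) n) (seq-eval p (upper b) n) ⟨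
      ∣ seq (evalℝ p (lower b)) n ℚ.- seq (evalℝ p (upper b)) n ∣ ∎
      where
      open ℚ.≤-Reasoning
      open Bracket
      bₙ = bisect b n

    root : ∃[ z ] (Within (l , r) z × evalℝ p z ≈ 0ℝ)
    root = lower b , lower-within b , null-≤ eval-bound eval-lower≈upper

  by-sign : Opposite (evalℚ p l) (evalℚ p r) → ∃[ z ] (Within (l , r) z × evalℝ p z ≈ 0ℝ)
  by-sign (inj₁ (pl≤0 , 0≤pr)) = root {λ x → evalℚ p x ℚ.≤ 0ℚ} {λ x → 0ℚ ℚ.≤ evalℚ p x}
    (λ x → ℚ.≤-total (evalℚ p x) 0ℚ) (λ s t → inj₁ (s , t)) pl≤0 0≤pr
  by-sign (inj₂ (0≤pl , pr≤0)) = root {λ x → 0ℚ ℚ.≤ evalℚ p x} {λ x → evalℚ p x ℚ.≤ 0ℚ}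
    (λ x → ℚ.≤-total 0ℚ (evalℚ p x)) (λ s t → inj₂ (s , t)) 0≤pl pr≤0

-- Isolating intervals and inertia

Interval : Set
Interval = ℚ × ℚ

Before : Interval → Interval → Set
Before (_ , r) (l , _) = r ℚ.< l

-- The gap between the two intervals is the lower bound δ.
before⇒regular : ∀ {I J z w} → Within I z → Within J w → Before I J →
                 Regular ℝ-commutativeRing (w +ℝ - z)
before⇒regular {I} {J} {z} {w} z∈I w∈J r<l = ≥-pos⇒regular (w +ℝ - z) (proj₁ J ℚ.- proj₂ I)
  (subst (ℚ._< proj₁ J ℚ.- proj₂ I) (ℚ.+-inverseʳ (proj₂ I)) (ℚ.+-monoˡ-< (ℚ.- proj₂ I) r<l))
  (λ n → ℚ.+-mono-≤ (proj₁ (w∈J n)) (ℚ.neg-antimono-≤ (proj₂ (z∈I n))))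

all-regular : ∀ {n I z} {Js : Vec Interval n} {ws : Vec ℝ n} → Within I z → Pointwise Within Js ws →
              All (Before I) Js → All (λ w → Regular ℝ-commutativeRing (w +ℝ - z)) ws
all-regular z∈I [] [] = []
all-regular {I = I} {z} {J ∷ _} {w ∷ _} z∈I (w∈J ∷ ws∈Js) (b ∷ bs) =
  before⇒regular {I} {J} {z} {w} z∈I w∈J b ∷ all-regular {I = I} {z = z} z∈I ws∈Js bs

allPairs-regular : ∀ {n} {Is : Vec Interval n} {zs : Vec ℝ n} →
                   Pointwise Within Is zs → AllPairs Before Is →
                   AllPairs (λ z w → Regular ℝ-commutativeRing (w +ℝ - z)) zs
allPairs-regular [] [] = []
allPairs-regular {Is = I ∷ _} {z ∷ _} (z∈I ∷ zs∈Is) (b ∷ bs) =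
  all-regular {I = I} {z = z} z∈I zs∈Is b ∷ allPairs-regular zs∈Is bs

roots : ∀ p {n} {Is : Vec Interval n} → All (Changes p) Is →
        ∃[ zs ] (Pointwise Within Is zs × All (λ z → evalℝ p z ≈ 0ℝ) {n} zs)
roots p []                      = [] , [] , []
roots p {Is = I ∷ _} (ch ∷ chs) with intermediate-root p I ch | roots p chs
... | z , z∈I , pz≈0 | zs , zs∈Is , pzs≈0 = z ∷ zs , z∈I ∷ zs∈Is , pz≈0 ∷ pzs≈0

IsolatedBy : ∀ {n} → List ℤ → Vec Interval n → Set
IsolatedBy p Is = All (Changes p) Is × AllPairs Before Is

-- Every condition compares rationals, so concrete data are verified by evaluation.
isolatedBy? : ∀ {n} p (Is : Vec Interval n) → Dec (IsolatedBy p Is)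
isolatedBy? p Is = All.all? changes? Is ×-dec AllPairs.allPairs? (λ (_ , r) (l , _) → r ℚ.<? l) Is
  where
  changes? : ∀ I → Dec (Changes p I)
  changes? (l , r) = (l ℚ.≤? r) ×-dec
    (((s ℚ.≤? 0ℚ) ×-dec (0ℚ ℚ.≤? t)) ⊎-dec ((0ℚ ℚ.≤? s) ×-dec (t ℚ.≤? 0ℚ)))
    where
    s = evalℚ p l
    t = evalℚ p r

-- Each root stays paired with its interval, from which its sign is later read; the sign of a real
-- by itself is undecidable.
record Splitting {n} (p : List ℤ) (Is : Vec Interval n) : Set where
  field
    zs       : Vec ℝ n
    zs∈Is    : Pointwise Within Is zs
    factored : _SplitsAs_ ℝ-commutativeRing (List.map ι p) zs

open Splitting

isolated⇒splitting : ∀ {n p} {Is : Vec Interval n} → Monic ℝ-commutativeRing n (List.map ι p) →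
                     IsolatedBy p Is → Splitting p Is
isolated⇒splitting {p = p} monic (chs , bs) =
  let ws , ws∈Is , pws≈0 = roots p chs
  in record
    { zs       = ws
    ; zs∈Is    = ws∈Is
    ; factored = factor ℝ-commutativeRing monic ws pws≈0 (allPairs-regular ws∈Is bs) }

-- A root common to both factors is listed once in each half, which accounts for its multiplicity.
splitting-* : ∀ {m n p q} {Is : Vec Interval m} {Js : Vec Interval n} →
              Splitting p Is → Splitting q Js → Splitting (mulᴾ p q) (Is ++ Js)
splitting-* {p = p} {q} S T = record
  { zs       = zs S ++ zs T
  ; zs∈Is    = Pointwise.++⁺ (zs∈Is S) (zs∈Is T)
  ; factored = splitsAs-++ ℝ-commutativeRing ι-hom p q (factored S) (factored T) }

-- An interval that avoids 0 certifies a nonzero eigenvalue; this is the source of n⁰ = 0.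
Signed : Interval → Set
Signed (l , r) = r ℚ.< 0ℚ ⊎ 0ℚ ℚ.< l

signed? : ∀ I → Dec (Signed I)
signed? (l , r) = (r ℚ.<? 0ℚ) ⊎-dec (0ℚ ℚ.<? l)

positives negatives : ∀ {n} {Is : Vec Interval n} → All Signed Is → ℕ
positives []            = 0
positives (inj₁ _ ∷ ss) = positives ss
positives (inj₂ _ ∷ ss) = suc (positives ss)
negatives []            = 0
negatives (inj₁ _ ∷ ss) = suc (negatives ss)
negatives (inj₂ _ ∷ ss) = negatives ss

signCount : ∀ {n} {Is : Vec Interval n} {zs : Vec ℝ n} →
            Pointwise Within Is zs → (ss : All Signed Is) →
            SignCount zs (positives ss) 0 (negatives ss)
signCount []              []            = SignCount.[]
signCount {Is = (l , r) ∷ _} {z ∷ _} (z∈I ∷ zs∈Is) (inj₁ r<0 ∷ ss) = SignCount.neg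
  -- The margin demanded by `_<_` is -r, the distance from the interval to 0, and it holds from
  -- index 0 on.
  (ℚ.- r , ℚ.neg-antimono-< r<0 , 0 , λ {n} _ →
    subst (seq z n ℚ.- r ℚ.≤_) (ℚ.+-inverseʳ r) (ℚ.+-monoˡ-≤ (ℚ.- r) (proj₂ (z∈I n))))
  (signCount zs∈Is ss)
signCount {Is = (l , r) ∷ _} {z ∷ _} (z∈I ∷ zs∈Is) (inj₂ 0<l ∷ ss) = SignCount.pos
  (l , 0<l , 0 , λ {n} _ → subst (ℚ._≤ seq z n) (sym (ℚ.+-identityˡ l)) (proj₁ (z∈I n)))
  (signCount zs∈Is ss)

-- C = (x² + x − 1)(x + 2) and D = C (x − 1)(x − 2) R with
-- R = x⁸ − 3x⁷ − 8x⁶ + 20x⁵ + 24x⁴ − 34x³ − 21x² + 15x − 2.  The characteristic polynomial of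
-- L(G₁₄) is C D; its double roots are those of C, and both factors are squarefree.
C D : List ℤ
C = ℤ.- + 2 ∷ + 1 ∷ + 3 ∷ + 1 ∷ []
D = + 8 ∷ ℤ.- + 76 ∷ + 202 ∷ ℤ.- + 5 ∷ ℤ.- + 479 ∷ + 202 ∷ + 435
  ∷ ℤ.- + 197 ∷ ℤ.- + 190 ∷ + 77 ∷ + 39 ∷ ℤ.- + 14 ∷ ℤ.- + 3 ∷ + 1 ∷ []

percent : ℤ × ℤ → Interval
percent (l , r) = l ℚ./ 100 , r ℚ./ 100

C-intervals : Vec Interval 3
C-intervals = Vec.map percent
  ((ℤ.- + 201 , ℤ.- + 199) ∷ (ℤ.- + 162 , ℤ.- + 161) ∷ (+ 61 , + 62) ∷ [])

-- The integer roots -2, 1 and 2 are centred in intervals of width 0.02; the others lie between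
-- consecutive hundredths. This grid separates even the closest pair, near 0.22 and 0.27.
D-intervals : Vec Interval 13
D-intervals = Vec.map percent
  ( (ℤ.- + 201 , ℤ.- + 199) ∷ (ℤ.- + 185 , ℤ.- + 184) ∷ (ℤ.- + 162 , ℤ.- + 161)
  ∷ (ℤ.- + 140 , ℤ.- + 139) ∷ (ℤ.- + 124 , ℤ.- + 123)
  ∷ (+ 22 , + 23) ∷ (+ 27 , + 28) ∷ (+ 61 , + 62) ∷ (+ 99 , + 101)
  ∷ (+ 128 , + 129) ∷ (+ 199 , + 201) ∷ (+ 252 , + 253) ∷ (+ 316 , + 317) ∷ [])

1≈1 : 1ℝ ≈ 1ℝ
1≈1 = ≗⇒≈ {1ℝ} {1ℝ} (λ _ → refl)

C-splitting : Splitting C C-intervals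
C-splitting = isolated⇒splitting {p = C} {C-intervals}
  (_ ∷ _ ∷ _ ∷ one 1≈1) (from-yes (isolatedBy? C C-intervals))

D-splitting : Splitting D D-intervals
D-splitting = isolated⇒splitting {p = D} {D-intervals}
  (_ ∷ _ ∷ _ ∷ _ ∷ _ ∷ _ ∷ _ ∷ _ ∷ _ ∷ _ ∷ _ ∷ _ ∷ _ ∷ one 1≈1)
  (from-yes (isolatedBy? D D-intervals))

CD-splitting : Splitting (mulᴾ C D) (C-intervals ++ D-intervals)
CD-splitting = splitting-* {p = C} {D} C-splitting D-splitting

-- Spectrum and inertia of the line graph

lineCharPoly : Graph → List ℤ
lineCharPoly G = Minors.mergedDet ℤ[X] zeroᴾ? (charMatrix (lineMatrix ℤ[X] (edges G)))

-- Both sides evaluate to normalised coefficient lists, so the decision procedure settles the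
-- equation by running the expansion.
G₁₄-charPoly : lineCharPoly G₁₄ ≡ mulᴾ C D
G₁₄-charPoly = from-yes (List.≡-dec ℤ._≟_ (lineCharPoly G₁₄) (mulᴾ C D))

ℝ-Spectrum : ∀ {n} → Matrix ℝ-rawRing n → Vec ℝ n → Set
ℝ-Spectrum = Spectrum ℝ-rawRing ℝ-isCommutativeRing

isSpectrum : ∀ {n} (A : Matrix ℝ-rawRing n) (λs : Vec ℝ n) → ℝ-Spectrum A λs → IsSpectrum A λs
isSpectrum A λs σ x = χ≈
  where
  χ≈ : charPoly ℝ-rawRing A x ≈ product (λ i → x +ℝ - Vec.lookup {A = ℝ} λs i)
  χ≈ = charPoly≈ ℝ-rawRing ℝ-isCommutativeRing {A = A} {zs = λs} σ
    {Vec.lookup {A = ℝ} λs} {_+ℝ_} { -_ } (λ _ → refl) refl refl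
    x {product (λ i → x +ℝ - Vec.lookup {A = ℝ} λs i)} refl

lineGraph-spectrum : ∀ G {p} {λs : Vec ℝ (length (edges G))} →
  lineCharPoly G ≡ p → _SplitsAs_ ℝ-commutativeRing (List.map ι p) λs →
  ℝ-Spectrum (Graph.adjacency (lineGraph G)) λs
lineGraph-spectrum G χ≡p split = lineMatrix-spectrum ℝ-rawRing ℝ-isCommutativeRing ι-hom (edges G)
  {Graph.adjacency (lineGraph G)} (λ _ _ → refl) χ≡p split

lineGraph-inertia : ∀ G {p} {λs : Vec ℝ (length (edges G))} {n⁺ n⁰ n⁻} →
  lineCharPoly G ≡ p → _SplitsAs_ ℝ-commutativeRing (List.map ι p) λs →
  SignCount λs n⁺ n⁰ n⁻ → HasInertia (lineGraph G) (n⁺ , n⁰ , n⁻)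
lineGraph-inertia G {λs = λs} χ≡p split signs =
  λs , isSpectrum (Graph.adjacency (lineGraph G)) λs (lineGraph-spectrum G χ≡p split) , signs

G₁₄-inertia : HasInertia (lineGraph G₁₄) (9 , 0 , 7)
-- The vector lengths agree because `length (edges G₁₄)` evaluates to 16 = 3 + 13.
G₁₄-inertia = lineGraph-inertia G₁₄ {λs = zs CD-splitting} G₁₄-charPoly (factored CD-splitting)
  (signCount (zs∈Is CD-splitting) (from-yes (All.all? signed? (C-intervals ++ D-intervals))))

-- Moving to ever smaller neighbours ends at `root`; one such walk followed by the reverse of
-- another joins any two vertices. Connectedness thus becomes a finite check.
descending⇒connected : ∀ {n} {_~_ : Rel (Fin n) 0ℓ} → Symmetric _~_ → ∀ root →
                       (∀ i → i ≡ root ⊎ ∃[ j ] (j Fin.< i × i ~ j)) → ∀ i j → Star _~_ i j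
descending⇒connected {_~_ = _~_} sym-~ root descend i j =
  path i (<-wellFounded i) ◅◅ Star.reverse sym-~ (path j (<-wellFounded j))
  where
  path : ∀ i → Acc Fin._<_ i → Star _~_ i root
  path i (acc rec) with descend i
  ... | inj₁ refl            = Star.ε
  ... | inj₂ (j , j<i , i~j) = i~j ◅ path j (rec j<i)

G₁₄-connected : Connected G₁₄
G₁₄-connected = _ , descending⇒connected sym-~ zero
  -- The numbering runs through the square and then around each pentagon from its attaching vertex,
  -- so every vertex but a has a smaller neighbour.
  (from-yes (Fin.all? λ i → (i Fin.≟ zero) ⊎-dec Fin.any? λ j → (j Fin.<? i) ×-dec (i ~? j)))
  where open Graph G₁₄

open import Data.Nat.Base using (_≤_; _+_)

proposition2 : HasInertia (lineGraph G₁₄) (9 , 0 , 7)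
    × HasSignature (lineGraph G₁₄) (+ 2)
    × ¬ ((G : Graph) → Graph.Connected G →
    ∀ n⁺ n⁰ n⁻ → HasInertia (lineGraph G) (n⁺ , n⁰ , n⁻) → n⁺ ≤ n⁻ + 1)
proposition2 = G₁₄-inertia , (9 , 0 , 7 , G₁₄-inertia , refl) ,
  -- The bound would give 9 ≤ 7 + 1, against 8 < 9, which unfolds to 9 ≤ 9.
  λ bound → ℕ.≤⇒≯ (bound G₁₄ G₁₄-connected 9 0 7 G₁₄-inertia) ℕ.≤-refl
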